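{- Let $G=(V,E)$ be a finite tree with positive real edge lengths $\{\alpha_e : e\in E\}$, and let $D$ be the corresponding distance matrix, whose $(u,v)$-entry is the sum of $\alpha_e$ over the edges $e$ on the unique path from $u$ to $v$. For any nonempty subset $S\subseteq V$, with $D[S]$ the principal submatrix indexed by $S$, \[ \det D[S] = (-1)^{|S|-1} 2^{|S|-2}\Bigg( \sum_{e\in E}\alpha_e \sum_{T\in\mathcal{F}_1(G;S)} w(T) \;-\; \sum_{F\in\mathcal{F}_2(G;S)} w(F)\,\big(\operatorname{outdeg}(F,*)-2\big)^2\Bigg). \]
   Context: A spanning forest of $G$ is an acyclic subgraph containing all vertices of $G$. $\mathcal{F}_1(G;S)$ is the set of $S$-rooted spanning forests: spanning forests each of whose connected components contains exactly one vertex of $S$. $\mathcal{F}_2(G;S)$ is the set of $(S,*)$-rooted spanning forests: spanning forests with $|S|+1$ components, $|S|$ of which each contain exactly one vertex of $S$, and one further component (the floating component $F(*)$) containing no vertex of $S$. $\operatorname{outdeg}(F,*)$ is the number of edges of $G$ with exactly one endpoint in the vertex set of $F(*)$. For a subgraph $H$ with edge set $A\subseteq E$, its weight is $w(H)=\prod_{e\in E\setminus A}\alpha_e$. -}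

module Defs where

open import Level using (Level; _⊔_)
open import Data.Nat using (ℕ; zero; suc) renaming (_+_ to _+ℕ_)
open import Data.Sum using (_⊎_)
import Data.Fin as Fin
open import Data.Fin using (Fin; zero; suc; toℕ; punchIn)
open import Data.Fin.Subset using (Subset; _∈_; _∉_)
open import Data.Bool using (Bool; true; false; if_then_else_; _xor_)
open import Data.Vec using (lookup)
open import Data.List using (List; []; _∷_)
open import Data.List.Relation.Unary.All using (All)
open import Data.List.Relation.Unary.Unique.Propositional using (Unique)
open import Data.Product using (Σ; ∃; ∃-syntax; _×_; _,_; proj₁; proj₂)
open import Data.Unit using (⊤)
open import Relation.Binary.PropositionalEquality using (_≡_; _≢_)
open import Relation.Nullary using (¬_)
open import Algebra.Bundles using (CommutativeRing)

-- Finite (multi)graphs: vertex set Fin n, edge set Fin m,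
-- edge e has endpoints  ends e.

Graph : ℕ → ℕ → Set
Graph n m = Fin m → Fin n × Fin n

module _ {n m : ℕ} (G : Graph n m) where

  Joins : Fin m → Fin n → Fin n → Set
  Joins e u w = (G e ≡ (u , w)) ⊎ (G e ≡ (w , u))

  data Walk : Fin n → Fin n → List (Fin m) → List (Fin n) → Set where
    nil  : ∀ {u} → Walk u u [] (u ∷ [])
    step : ∀ {u w v e es vs} → Joins e u w → Walk w v es vs →
           Walk u v (e ∷ es) (u ∷ vs)

  IsPath : ∀ {u v es vs} → Walk u v es vs → Set
  IsPath {vs = vs} _ = Unique vs

  ConnVia : (Fin m → Set) → Fin n → Fin n → Set
  ConnVia P u v = ∃[ es ] ∃[ vs ] (Walk u v es vs × All P es)

  Conn : Subset m → Fin n → Fin n → Set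
  Conn A = ConnVia (λ f → f ∈ A)

  -- the spanning subgraph with edge set A is acyclic:
  -- no edge of A lies on a cycle in A, i.e. the endpoints of any edge e ∈ A
  -- are not connected in A ∖ {e}.
  Acyclic : Subset m → Set
  Acyclic A = ∀ e → e ∈ A →
    ¬ ConnVia (λ f → (f ∈ A) × (f ≢ e)) (proj₁ (G e)) (proj₂ (G e))

  IsTree : Set
  IsTree = (∀ u v → ConnVia (λ _ → ⊤) u v) ×
           (∀ e → ¬ ConnVia (λ f → f ≢ e) (proj₁ (G e)) (proj₂ (G e)))

  module _ {k : ℕ} (S : Fin k → Fin n) where

    IsF1 : Subset m → Set
    IsF1 A = Acyclic A ×
      (∀ v → (∃[ i ] Conn A v (S i)) ×
             (∀ i j → Conn A v (S i) → Conn A v (S j) → i ≡ j))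

    Floating : Subset m → Fin n → Set
    Floating A v = ¬ (∃[ i ] Conn A v (S i))

    -- (S,*)-rooted spanning forests F₂(G;S): the components containing the
    -- vertices of S are pairwise distinct (one vertex of S each), and the
    -- remaining vertices form exactly one further (nonempty) component F(*).
    -- Fl is the vertex set of the floating component F(*).
    IsF2 : Subset m → Subset n → Set
    IsF2 A Fl = Acyclic A ×
      (∀ i j → Conn A (S i) (S j) → i ≡ j) ×
      (∃[ v ] Floating A v) ×
      (∀ u v → Floating A u → Floating A v → Conn A u v) ×
      (∀ v → (v ∈ Fl → Floating A v) × (Floating A v → v ∈ Fl))

outdeg : ∀ {n m} → Graph n m → Subset n → ℕ
outdeg {m = zero} G Fl = 0
outdeg {m = suc m} G Fl =
  (if lookup Fl (proj₁ (G Fin.zero)) xor lookup Fl (proj₂ (G Fin.zero)) then 1 else 0)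
  +ℕ outdeg (λ e → G (Fin.suc e)) Fl

module _ {c ℓ} (R : CommutativeRing c ℓ) where
  open CommutativeRing R

  sumFin : ∀ m → (Fin m → Carrier) → Carrier
  sumFin zero f = 0#
  sumFin (suc m) f = f Fin.zero + sumFin m (λ i → f (Fin.suc i))

  prodFin : ∀ m → (Fin m → Carrier) → Carrier
  prodFin zero f = 1#
  prodFin (suc m) f = f Fin.zero * prodFin m (λ i → f (Fin.suc i))

  sumList : {A : Set} → (A → Carrier) → List A → Carrier
  sumList f [] = 0#
  sumList f (x ∷ xs) = f x + sumList f xs

  natR : ℕ → Carrier
  natR zero = 0#
  natR (suc k) = 1# + natR k

  sgn : ℕ → Carrier
  sgn zero = 1#
  sgn (suc k) = - sgn k

  pow2 : ℕ → Carrier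
  pow2 zero = 1#
  pow2 (suc k) = (1# + 1#) * pow2 k

  det : ∀ k → (Fin k → Fin k → Carrier) → Carrier
  det zero M = 1#
  det (suc k) M = sumFin (suc k) (λ j →
    sgn (toℕ j) * (M Fin.zero j * det k (λ r s → M (Fin.suc r) (punchIn j s))))

  weight : ∀ {m} → (Fin m → Carrier) → Subset m → Carrier
  weight {m} α A = prodFin m (λ e → if lookup A e then 1# else α e)

  IsDistanceMatrix : ∀ {n m} → Graph n m → (Fin m → Carrier) →
                     (Fin n → Fin n → Carrier) → Set ℓ
  IsDistanceMatrix G α D = ∀ u v es vs → (p : Walk G u v es vs) → IsPath G p →
    D u v ≈ sumList α es

  -- 2^(k-1) for k ≥ 0, where 2^(-1) is the given inverse `half` of 2;
  -- with |S| = k+1 this is 2^(|S|-2)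
  pow2m1 : Carrier → ℕ → Carrier
  pow2m1 half zero = half
  pow2m1 half (suc k) = pow2 k

module Submission where

-- Removing an edge e of the tree splits V into two sides; put x_e(v) = ±1
-- accordingly and s = Σ α_e. Two vertices are separated by e with weight
-- (1 - x_e(u) x_e(v)) / 2, so 2 D[S] = s 1 1ᵗ - Σ_e α_e x_e x_eᵗ, and
-- Cauchy–Binet writes det D[S] as a sum over sets B of deleted edges of
-- squares of minors of the matrix of the rows 1 and x_e.
-- With the row 1, the minor of B is ±2^(|S|-1) if E ∖ B is an S-rooted forest
-- and 0 otherwise. Without it, the minor is ±2^(|S|-1) (2 - outdeg(F,*)) if
-- E ∖ B is an (S,*)-rooted forest and 0 otherwise. Both are found by
-- multiplying with the reduced incidence matrix of the tree obtained by
-- contracting E ∖ B, which has an integral inverse and hence determinant ±1.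

open import Defs
open import Level using (Level)
open import Data.Bool using (Bool; true; false; if_then_else_; _xor_; not)
import Data.Bool.Properties as Boolₚ
open import Data.Empty using (⊥-elim)
open import Data.Fin using (Fin; zero; suc; toℕ; punchIn; _≟_)
import Data.Fin.Properties as Finₚ
open import Data.Fin.Subset using (Subset; _∈_)
open import Data.Integer as ℤ using (ℤ; +_; -[1+_])
import Data.Integer.Properties as ℤₚ
open import Data.List using (List; []; _∷_)
open import Data.List.Membership.Propositional using () renaming (_∈_ to _∈L_; _∉_ to _∉L_)
open import Data.List.Relation.Unary.All as All using (All; []; _∷_)
open import Data.List.Relation.Unary.AllPairs using (AllPairs; []; _∷_)
open import Data.List.Relation.Unary.Any using (here; there)
open import Data.List.Relation.Unary.Unique.Propositional using (Unique)
open import Data.Maybe using (Maybe; just; nothing)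
open import Data.Nat as ℕ using (ℕ; zero; suc; s≤s; z≤n)
import Data.Nat.Properties as ℕₚ
open import Data.Product using (∃; ∃₂; _×_; _,_; proj₁; proj₂)
open import Data.Sum as Sum using (_⊎_; inj₁; inj₂)
open import Data.Vec using (lookup; tabulate; replicate; []; _∷_)
open import Data.Vec.Properties
  using ([]=⇒lookup; lookup⇒[]=; lookup∘tabulate; tabulate∘lookup; tabulate-cong; ∷-injectiveʳ; ≡-dec)
open import Function using (_∘_; id)
open import Function.Bundles using (_⇔_; Equivalence)
open import Function.Definitions using (Injective)
open import Relation.Binary.PropositionalEquality as ≡ using (_≡_; _≢_)
open import Relation.Nullary using (¬_; Dec; yes; no; does)
open import Relation.Nullary.Decidable using (dec-true; dec-false; ¬?; _→-dec_; _×-dec_)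
open import Algebra.Bundles using (CommutativeRing)
open import Algebra.Solver.Ring.AlmostCommutativeRing
  using (fromCommutativeRing; _-Raw-AlmostCommutative⟶_)

-- The signs of the minors are never computed: minors enter squared, so it is enough that the
-- incidence determinant squares to 1. In an arbitrary commutative ring an inverse matrix only makes
-- a determinant a unit; that determinant is therefore treated over the integers, where the units
-- are 1 and -1, and carried to `R`. The integral inverse is the signed path matrix of the
-- contracted tree. The number outdeg(F,*) enters as a trace. The floating component has no column
-- in the minor, and its absence changes the product 2I of spins and incidence vectors by a rank one
-- matrix whose trace is minus the degree of that component. Connectivity by walks is replaced by a
-- decidable condition: two vertices lie in one component exactly if no deleted edge separates them.
-- This settles the vanishing cases: two vertices of S in one component give equal columns, and if
-- there are none, a set that is not a forest of the required kind has the wrong number of deleted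
-- edges.

-- The map from the integers and the ring solver built on it.

module FromℤHom {c ℓ} (R : CommutativeRing c ℓ) where
  open CommutativeRing R
  open import Algebra.Properties.Ring ring
  open import Algebra.Properties.Semiring.Mult.TCOptimised semiring
    using (1+×; ×-homo-+; ×1-homo-*) renaming (_×_ to _·_)
  open import Relation.Binary.Reasoning.Setoid setoid

  -- With this form of the multiple, `φ (+ 1)` and `φ (+ 2)` reduce to `1#` and `1# + 1#`, so solver
  -- constants match the goals definitionally. The same map later carries integer determinants to
  -- `R`.
  φ : ℤ → Carrier
  φ (+ n)    = n · 1#
  φ -[1+ n ] = - (suc n · 1#)

  φ-neg : ∀ i → φ (ℤ.- i) ≈ - φ i
  φ-neg (+ zero)  = sym -0#≈0#
  φ-neg (+ suc n) = refl
  φ-neg -[1+ n ]  = sym (-‿involutive _)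

  private
    cancel-suc : ∀ x y → (1# + x) - (1# + y) ≈ x - y
    cancel-suc x y = begin
      (1# + x) - (1# + y)     ≈⟨ +-cong (+-comm 1# x) (sym (-‿+-comm 1# y)) ⟩
      (x + 1#) + (- 1# - y)   ≈⟨ +-assoc x 1# _ ⟩
      x + (1# + (- 1# - y))   ≈⟨ +-congˡ (+-assoc 1# (- 1#) _) ⟨
      x + ((1# - 1#) - y)     ≈⟨ +-congˡ (+-congʳ (-‿inverseʳ 1#)) ⟩
      x + (0# - y)            ≈⟨ +-congˡ (+-identityˡ _) ⟩
      x - y                   ∎

  φ-⊖ : ∀ m n → φ (m ℤ.⊖ n) ≈ m · 1# - n · 1#
  φ-⊖ zero    zero    = sym (-‿inverseʳ 0#)
  φ-⊖ zero    (suc n) = sym (+-identityˡ _)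
  φ-⊖ (suc m) zero    = sym (trans (+-congˡ -0#≈0#) (+-identityʳ _))
  φ-⊖ (suc m) (suc n) = begin
    φ (suc m ℤ.⊖ suc n)            ≡⟨ ≡.cong φ (ℤₚ.[1+m]⊖[1+n]≡m⊖n m n) ⟩
    φ (m ℤ.⊖ n)                    ≈⟨ φ-⊖ m n ⟩
    m · 1# - n · 1#                ≈⟨ cancel-suc _ _ ⟨
    (1# + m · 1#) - (1# + n · 1#)  ≈⟨ +-cong (1+× m 1#) (-‿cong (1+× n 1#)) ⟨
    suc m · 1# - suc n · 1#        ∎

  φ-+ : ∀ i j → φ (i ℤ.+ j) ≈ φ i + φ j
  φ-+ (+ m)    (+ n)    = ×-homo-+ 1# m n
  φ-+ (+ m)    -[1+ n ] = φ-⊖ m (suc n)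
  φ-+ -[1+ m ] (+ n)    = trans (φ-⊖ n (suc m)) (+-comm _ _)
  φ-+ -[1+ m ] -[1+ n ] = begin
    - (suc (suc (m ℕ.+ n)) · 1#)     ≡⟨ ≡.cong (λ k → - (suc k · 1#)) (ℕₚ.+-suc m n) ⟨
    - ((suc m ℕ.+ suc n) · 1#)       ≈⟨ -‿cong (×-homo-+ 1# (suc m) (suc n)) ⟩
    - (suc m · 1# + suc n · 1#)      ≈⟨ -‿+-comm _ _ ⟨
    - (suc m · 1#) - (suc n · 1#)    ∎

  φ-pos-* : ∀ m n → φ (+ m ℤ.* + n) ≈ φ (+ m) * φ (+ n)
  φ-pos-* m n = trans (reflexive (≡.cong φ (≡.sym (ℤₚ.pos-* m n)))) (×1-homo-* m n)

  φ-pos-*ʳ : ∀ m j → φ (+ m ℤ.* j) ≈ φ (+ m) * φ j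
  φ-pos-*ʳ m (+ n)    = φ-pos-* m n
  φ-pos-*ʳ m -[1+ n ] = begin
    φ (+ m ℤ.* -[1+ n ])          ≡⟨ ≡.cong φ (ℤₚ.neg-distribʳ-* (+ m) (+ suc n)) ⟨
    φ (ℤ.- (+ m ℤ.* + suc n))     ≈⟨ φ-neg (+ m ℤ.* + suc n) ⟩
    - φ (+ m ℤ.* + suc n)         ≈⟨ -‿cong (φ-pos-* m (suc n)) ⟩
    - (φ (+ m) * φ (+ suc n))     ≈⟨ -‿distribʳ-* _ _ ⟩
    φ (+ m) * φ -[1+ n ]          ∎

  φ-* : ∀ i j → φ (i ℤ.* j) ≈ φ i * φ j
  φ-* (+ m)    j = φ-pos-*ʳ m j
  φ-* -[1+ m ] j = begin
    φ (-[1+ m ] ℤ.* j)            ≡⟨ ≡.cong φ (ℤₚ.neg-distribˡ-* (+ suc m) j) ⟨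
    φ (ℤ.- (+ suc m ℤ.* j))       ≈⟨ φ-neg (+ suc m ℤ.* j) ⟩
    - φ (+ suc m ℤ.* j)           ≈⟨ -‿cong (φ-pos-*ʳ (suc m) j) ⟩
    - (φ (+ suc m) * φ j)         ≈⟨ -‿distribˡ-* _ _ ⟩
    φ -[1+ m ] * φ j              ∎

  φ-morphism : ℤ.+-*-rawRing -Raw-AlmostCommutative⟶ fromCommutativeRing R
  φ-morphism = record
    { ⟦_⟧ = φ ; +-homo = φ-+ ; *-homo = φ-* ; -‿homo = φ-neg
    ; 0-homo = refl ; 1-homo = refl }

  -- One-sided, because `φ` need not be injective: `nothing` refutes no equality.
  φ-≟ : ∀ i j → Maybe (φ i ≈ φ j)
  φ-≟ i j with i ℤ.≟ j
  ... | yes i≡j = just (reflexive (≡.cong φ i≡j))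
  ... | no  _   = nothing

  open import Algebra.Solver.Ring ℤ.+-*-rawRing (fromCommutativeRing R) φ-morphism φ-≟ public
    using (solve; _:+_; _:*_; _:-_; :-_; _:=_; con)

-- Row replacement and enumeration of deleted edges.

infixr 5 _◂_
_◂_ : ∀ {a} {A : Set a} {k} → A → (Fin k → A) → Fin (suc k) → A
(x ◂ f) zero    = x
(x ◂ f) (suc i) = f i

put : ∀ {a} {A : Set a} {k} → (Fin k → A) → Fin k → A → Fin k → A
put f zero    x zero    = x
put f zero    x (suc r) = f (suc r)
put f (suc i) x zero    = f zero
put f (suc i) x (suc r) = put (f ∘ suc) i x r

put-updates : ∀ {a} {A : Set a} {k} (f : Fin k → A) i x → put f i x i ≡ x
put-updates f zero    x = ≡.refl
put-updates f (suc i) x = put-updates (f ∘ suc) i x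

-- Applied with `g` dropping a column of a matrix: replacing a row commutes with passing to the
-- columns of a minor.
put-map : ∀ {a b} {A : Set a} {B : Set b} {k} (g : A → B) (f : Fin k → A) i x r →
          g (put f i x r) ≡ put (g ∘ f) i (g x) r
put-map g f zero    x zero    = ≡.refl
put-map g f zero    x (suc r) = ≡.refl
put-map g f (suc i) x zero    = ≡.refl
put-map g f (suc i) x (suc r) = put-map g (f ∘ suc) i x r

-- Edge sets are represented by the set A of edges they keep: `cut A` counts
-- the edges outside A, and `cutEdge A` enumerates them.
cut : ∀ {m} → Subset m → ℕ
cut []          = 0
cut (true  ∷ A) = cut A
cut (false ∷ A) = suc (cut A)

cutEdge : ∀ {m} (A : Subset m) → Fin (cut A) → Fin m
cutEdge (true  ∷ A) p       = suc (cutEdge A p)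
cutEdge (false ∷ A) zero    = zero
cutEdge (false ∷ A) (suc p) = suc (cutEdge A p)

cut≤ : ∀ {m} (A : Subset m) → cut A ℕ.≤ m
cut≤ []          = z≤n
cut≤ (true  ∷ A) = ℕₚ.m≤n⇒m≤1+n (cut≤ A)
cut≤ (false ∷ A) = s≤s (cut≤ A)

cut-all : ∀ {m} (A : Subset m) → cut A ≡ m → A ≡ replicate m false
cut-all []          eq = ≡.refl
cut-all (true  ∷ A) eq = ⊥-elim (ℕₚ.<⇒≱ (s≤s (cut≤ A)) (ℕₚ.≤-reflexive (≡.sym eq)))
cut-all (false ∷ A) eq = ≡.cong (false ∷_) (cut-all A (ℕₚ.suc-injective eq))

cutEdge-∉ : ∀ {m} (A : Subset m) p → lookup A (cutEdge A p) ≡ false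
cutEdge-∉ (true  ∷ A) p       = cutEdge-∉ A p
cutEdge-∉ (false ∷ A) zero    = ≡.refl
cutEdge-∉ (false ∷ A) (suc p) = cutEdge-∉ A p

cutEdge-surjective : ∀ {m} (A : Subset m) e → lookup A e ≡ false → ∃ λ p → cutEdge A p ≡ e
cutEdge-surjective (true  ∷ A) (suc e) e∉A with cutEdge-surjective A e e∉A
... | p , eq = p , ≡.cong suc eq
cutEdge-surjective (false ∷ A) zero    e∉A = zero , ≡.refl
cutEdge-surjective (false ∷ A) (suc e) e∉A with cutEdge-surjective A e e∉A
... | p , eq = suc p , ≡.cong suc eq

cutEdge-injective : ∀ {m} (A : Subset m) {p q} → cutEdge A p ≡ cutEdge A q → p ≡ q
cutEdge-injective (true  ∷ A) eq = cutEdge-injective A (Finₚ.suc-injective eq)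
cutEdge-injective (false ∷ A) {zero}  {zero}  eq = ≡.refl
cutEdge-injective (false ∷ A) {suc p} {suc q} eq =
  ≡.cong suc (cutEdge-injective A (Finₚ.suc-injective eq))

-- Determinants: alternation and rank one updates.

module Determinant {c ℓ} (R : CommutativeRing c ℓ) where
  open CommutativeRing R hiding (zero)
  open import Algebra.Properties.Ring ring
  open import Relation.Binary.Reasoning.Setoid setoid
  open FromℤHom R

  Row : ℕ → Set c
  Row n = Fin n → Carrier

  Matrix : ℕ → ℕ → Set c
  Matrix k n = Fin k → Row n

  sg : ∀ {n} → Fin n → Carrier
  sg j = sgn R (toℕ j)

  ⟦_⟧ : Bool → Carrier
  ⟦ true  ⟧ = 1#
  ⟦ false ⟧ = 0#

  spin : Bool → Carrier
  spin true  = 1#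
  spin false = - 1#

  δ : ∀ {n} → Matrix n n
  δ i j = ⟦ does (i ≟ j) ⟧

  -- Opaque, so that summands can be inferred by unification.
  opaque
    ∑ : ∀ {n} → Row n → Carrier
    ∑ {n} f = sumFin R n f

    ∑≡sumFin : ∀ {n} (f : Row n) → ∑ f ≡ sumFin R n f
    ∑≡sumFin f = ≡.refl

    ∑-empty : (f : Row 0) → ∑ f ≈ 0#
    ∑-empty f = refl

    ∑-suc : ∀ {n} (f : Row (suc n)) → ∑ f ≈ f zero + ∑ (f ∘ suc)
    ∑-suc f = refl

    ∑-cong : ∀ {n} {f g : Row n} → (∀ i → f i ≈ g i) → ∑ f ≈ ∑ g
    ∑-cong {zero}  f≈g = refl
    ∑-cong {suc n} f≈g = +-cong (f≈g zero) (∑-cong (f≈g ∘ suc))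

    ∑-zero : ∀ {n} {f : Row n} → (∀ i → f i ≈ 0#) → ∑ f ≈ 0#
    ∑-zero {zero}  f≈0 = refl
    ∑-zero {suc n} f≈0 = trans (+-cong (f≈0 zero) (∑-zero (f≈0 ∘ suc))) (+-identityˡ 0#)

    ∑-+ : ∀ {n} (f g : Row n) → ∑ (λ i → f i + g i) ≈ ∑ f + ∑ g
    ∑-+ {zero}  f g = sym (+-identityˡ 0#)
    ∑-+ {suc n} f g = trans (+-congˡ (∑-+ (f ∘ suc) (g ∘ suc)))
      (solve 4 (λ a b x y → (a :+ b) :+ (x :+ y) := (a :+ x) :+ (b :+ y)) refl _ _ _ _)

    ∑-*ˡ : ∀ {n} x (f : Row n) → ∑ (λ i → x * f i) ≈ x * ∑ f
    ∑-*ˡ {zero}  x f = sym (zeroʳ x)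
    ∑-*ˡ {suc n} x f = trans (+-congˡ (∑-*ˡ x (f ∘ suc))) (sym (distribˡ x _ _))

  ∑-neg : ∀ {n} (f : Row n) → ∑ (λ i → - f i) ≈ - ∑ f
  ∑-neg f = trans (∑-cong (λ i → sym (-1*x≈-x (f i)))) (trans (∑-*ˡ (- 1#) f) (-1*x≈-x _))

  ∑-minus : ∀ {n} (f g : Row n) → ∑ (λ i → f i - g i) ≈ ∑ f - ∑ g
  ∑-minus f g = trans (∑-+ f (λ i → - g i)) (+-congˡ (∑-neg g))

  ∑-swap : ∀ {n m} (f : Matrix n m) → ∑ (λ i → ∑ (f i)) ≈ ∑ (λ j → ∑ (λ i → f i j))
  ∑-swap {zero}  f = trans (∑-empty _) (sym (∑-zero (λ j → ∑-empty _)))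
  ∑-swap {suc n} f = trans (∑-suc _) (trans (+-congˡ (∑-swap (f ∘ suc)))
    (trans (sym (∑-+ (f zero) _)) (∑-cong (λ j → sym (∑-suc _)))))

  ∑-δ : ∀ {n} j (f : Row n) → ∑ (λ i → δ j i * f i) ≈ f j
  ∑-δ zero    f = trans (∑-suc _) (trans (+-cong (*-identityˡ _) (∑-zero (λ i → zeroˡ _))) (+-identityʳ _))
  ∑-δ (suc j) f = trans (∑-suc _) (trans (+-cong (zeroˡ _) (∑-δ j (f ∘ suc))) (+-identityˡ _))

  opaque
    unfolding ∑
    Det : ∀ {k} → Matrix k k → Carrier
    Det {k} M = det R k M

    Det≡det : ∀ {k} (M : Matrix k k) → Det M ≡ det R k M
    Det≡det M = ≡.refl

    Det-empty : (M : Matrix 0 0) → Det M ≈ 1#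
    Det-empty M = refl

    Det-suc : ∀ {k} (M : Matrix (suc k) (suc k)) →
      Det M ≈ ∑ (λ j → sg j * (M zero j * Det (λ r s → M (suc r) (punchIn j s))))
    Det-suc M = refl

  Det-cong : ∀ {k} {M N : Matrix k k} → (∀ i j → M i j ≈ N i j) → Det M ≈ Det N
  Det-cong {zero}  M≈N = trans (Det-empty _) (sym (Det-empty _))
  Det-cong {suc k} M≈N = trans (Det-suc _) (trans
    (∑-cong (λ j → *-congˡ (*-cong (M≈N zero j) (Det-cong (λ r s → M≈N (suc r) (punchIn j s))))))
    (sym (Det-suc _)))

  lift : ∀ {n k} → (Fin n → Fin k) → Fin (suc n) → Fin (suc k)
  lift g = zero ◂ (suc ∘ g)

  -- The pairs of columns (j , l) and (l , j) get opposite signs. The pairs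
  -- involving column 0 cancel directly, the others form the same sum with one
  -- column less.
  alternating-sum : ∀ n (w : Matrix (2 ℕ.+ n) (2 ℕ.+ n)) → (∀ i j → w i j ≈ w j i) →
    (h : (Fin n → Fin (2 ℕ.+ n)) → Carrier) →
    (∀ {g g′} → (∀ t → g t ≡ g′ t) → h g ≈ h g′) →
    ∑ (λ j → sg j * ∑ (λ s → sg s * (w j (punchIn j s) * h (λ t → punchIn j (punchIn s t))))) ≈ 0#
  alternating-sum n w w-sym h h-cong = begin
    ∑ (λ j → sg j * ∑ (λ s → sg s * (w j (punchIn j s) * h (λ t → punchIn j (punchIn s t)))))
      ≈⟨ trans (∑-suc _) (+-congˡ (∑-cong (λ j → *-congˡ (∑-suc _)))) ⟩
    1# * ∑ a + ∑ (λ j → - sg j * (1# * (w (suc j) zero * h (suc ∘ punchIn j)) + rest j))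
      ≈⟨ +-cong (*-identityˡ _) (trans (∑-cong split) (∑-+ (λ j → - a j) _)) ⟩
    ∑ a + (∑ (λ j → - a j) + ∑ (λ j → - (sg j * rest j)))
      ≈⟨ +-congˡ (+-cong (∑-neg a) (trans (∑-neg _) (-‿cong (rest≈0 n w w-sym h h-cong)))) ⟩
    ∑ a + (- ∑ a + - 0#)
      ≈⟨ solve 1 (λ a → a :+ (:- a :+ :- con (+ 0)) := con (+ 0)) refl (∑ a) ⟩
    0# ∎
    where
    a : Row (suc n)
    a s = sg s * (w zero (suc s) * h (suc ∘ punchIn s))
    rest : Row (suc n)
    rest j = ∑ (λ s → - sg s * (w (suc j) (suc (punchIn j s)) *
                                 h (λ t → punchIn (suc j) (punchIn (suc s) t))))
    split : ∀ j → - sg j * (1# * (w (suc j) zero * h (suc ∘ punchIn j)) + rest j)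
                  ≈ - a j + - (sg j * rest j)
    split j = trans
      (solve 4 (λ s w h r → :- s :* (con (+ 1) :* (w :* h) :+ r) :=
                            :- (s :* (w :* h)) :+ :- (s :* r)) refl _ _ _ _)
      (+-congʳ (-‿cong (*-congˡ (*-congʳ (w-sym (suc j) zero)))))
    rest≈0 : ∀ n (w : Matrix (2 ℕ.+ n) (2 ℕ.+ n)) → (∀ i j → w i j ≈ w j i) →
      (h : (Fin n → Fin (2 ℕ.+ n)) → Carrier) →
      (∀ {g g′} → (∀ t → g t ≡ g′ t) → h g ≈ h g′) →
      ∑ (λ j → sg j * ∑ (λ s → - sg s * (w (suc j) (suc (punchIn j s)) *
                                 h (λ t → punchIn (suc j) (punchIn (suc s) t))))) ≈ 0#
    rest≈0 zero    w w-sym h h-cong = ∑-zero (λ j → trans (*-congˡ (∑-empty _)) (zeroʳ _))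
    rest≈0 (suc n) w w-sym h h-cong = begin
      ∑ (λ j → sg j * ∑ (λ s → - sg s * (w (suc j) (suc (punchIn j s)) *
                                 h (λ t → punchIn (suc j) (punchIn (suc s) t)))))
        ≈⟨ ∑-cong (λ j → trans
             (*-congˡ (trans (∑-cong (λ s → trans (sym (-‿distribˡ-* _ _))
                                (-‿cong (*-congˡ (*-congˡ (h-cong
                                  λ { zero → ≡.refl ; (suc t) → ≡.refl }))))))
                             (∑-neg _)))
             (sym (-‿distribʳ-* _ _))) ⟩
      ∑ (λ j → - (sg j * ∑ (λ s → sg s * (w (suc j) (suc (punchIn j s)) *
                                 h (lift (λ t → punchIn j (punchIn s t)))))))
        ≈⟨ ∑-neg _ ⟩
      - ∑ (λ j → sg j * ∑ (λ s → sg s * (w (suc j) (suc (punchIn j s)) *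
                                 h (lift (λ t → punchIn j (punchIn s t))))))
        ≈⟨ -‿cong (alternating-sum n (λ i j → w (suc i) (suc j)) (λ i j → w-sym (suc i) (suc j))
             (h ∘ lift) (λ eq → h-cong λ { zero → ≡.refl ; (suc t) → ≡.cong suc (eq t) })) ⟩
      - 0#
        ≈⟨ -0#≈0# ⟩
      0# ∎

  module _ {n} (L : Matrix n (2 ℕ.+ n)) where
    private
      h : (Fin n → Fin (2 ℕ.+ n)) → Carrier
      h g = Det (λ r t → L r (g t))

      h-cong : ∀ {g g′} → (∀ t → g t ≡ g′ t) → h g ≈ h g′
      h-cong eq = Det-cong (λ r t → reflexive (≡.cong (L r) (eq t)))

      pairs : Matrix (2 ℕ.+ n) (2 ℕ.+ n) → Carrier
      pairs w = ∑ (λ j → sg j * ∑ (λ s → sg s * (w j (punchIn j s) * h (λ t → punchIn j (punchIn s t)))))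

      pairs-+ : ∀ w w′ → pairs (λ i j → w i j + w′ i j) ≈ pairs w + pairs w′
      pairs-+ w w′ = trans (∑-cong (λ j → trans (*-congˡ (trans (∑-cong (λ s →
          trans (*-congˡ (distribʳ _ _ _)) (distribˡ _ _ _))) (∑-+ _ _))) (distribˡ _ _ _)))
        (∑-+ _ _)

    -- Laplace expansion along two rows. The entries of `a` and `b` appear only as a coefficient
    -- depending on a pair of columns, which is the shape that `alternating-sum` handles.
    Det-two-rows : ∀ a b → Det (a ◂ b ◂ L) ≈
      ∑ (λ j → sg j * ∑ (λ s → sg s * ((a j * b (punchIn j s)) * h (λ t → punchIn j (punchIn s t)))))
    Det-two-rows a b = trans (Det-suc _) (∑-cong (λ j → *-congˡ (trans (*-congˡ (Det-suc _))
      (trans (sym (∑-*ˡ (a j) _)) (∑-cong (λ s →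
        solve 4 (λ a s b h → a :* (s :* (b :* h)) := s :* ((a :* b) :* h)) refl _ _ _ _))))))

    -- Proved directly: `Det-swap` would only show that twice the determinant vanishes, and 2 need
    -- not be cancellable here.
    Det-repeat : ∀ a → Det (a ◂ a ◂ L) ≈ 0#
    Det-repeat a = trans (Det-two-rows a a)
      (alternating-sum n (λ i j → a i * a j) (λ i j → *-comm _ _) h h-cong)

    -- The sum of both expansions has the symmetric coefficients `a i * b j + b i * a j`, hence
    -- vanishes.
    Det-swap : ∀ a b → Det (a ◂ b ◂ L) ≈ - Det (b ◂ a ◂ L)
    Det-swap a b = trans (Det-two-rows a b) (trans
      (+-inverseˡ-unique _ _ (trans (sym (pairs-+ (λ i j → a i * b j) (λ i j → b i * a j)))
        (alternating-sum n (λ i j → a i * b j + b i * a j)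
          (λ i j → trans (+-comm _ _) (+-cong (*-comm _ _) (*-comm _ _))) h h-cong)))
      (-‿cong (sym (Det-two-rows b a))))

  private
    -- The case of one size less is the parameter `ih`. If the twin of row 0 lies below row 1,
    -- swapping rows 0 and 1 puts both twins into every minor of the expansion along the new first
    -- row.
    Det-equal-first : ∀ {k} →
      (∀ (M : Matrix k k) i j → i ≢ j → (∀ t → M i t ≈ M j t) → Det M ≈ 0#) →
      ∀ (M : Matrix (suc k) (suc k)) j → (∀ t → M zero t ≈ M (suc j) t) → Det M ≈ 0#
    Det-equal-first {suc k} ih M zero eq =
      trans (Det-cong {N = M zero ◂ M zero ◂ (λ r → M (suc (suc r)))} λ
        { zero t → refl ; (suc zero) t → sym (eq t) ; (suc (suc r)) t → refl })
        (Det-repeat (λ r → M (suc (suc r))) (M zero))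
    Det-equal-first {suc k} ih M (suc j) eq = begin
      Det M
        ≈⟨ Det-cong (λ { zero t → refl ; (suc zero) t → refl ; (suc (suc r)) t → refl }) ⟩
      Det (M zero ◂ M (suc zero) ◂ L)
        ≈⟨ Det-swap L (M zero) (M (suc zero)) ⟩
      - Det (M (suc zero) ◂ M zero ◂ L)
        ≈⟨ -‿cong (trans (Det-suc _) (∑-zero (λ t → trans (*-congˡ (trans (*-congˡ
             (ih _ zero (suc j) (λ ()) (λ s → eq (punchIn t s)))) (zeroʳ _))) (zeroʳ _)))) ⟩
      - 0#  ≈⟨ -0#≈0# ⟩
      0#    ∎
      where L = λ r → M (suc (suc r))

  Det-equal-rows : ∀ {k} (M : Matrix k k) i j → i ≢ j → (∀ t → M i t ≈ M j t) → Det M ≈ 0#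
  Det-equal-rows M zero zero i≢j eq = ⊥-elim (i≢j ≡.refl)
  Det-equal-rows {suc k} M zero (suc j) i≢j eq = Det-equal-first Det-equal-rows M j eq
  Det-equal-rows {suc k} M (suc i) zero i≢j eq = Det-equal-first Det-equal-rows M i (λ t → sym (eq t))
  Det-equal-rows {suc k} M (suc i) (suc j) i≢j eq = trans (Det-suc M) (∑-zero (λ t →
    trans (*-congˡ (trans (*-congˡ
      (Det-equal-rows _ i j (i≢j ∘ ≡.cong suc) (λ s → eq (punchIn t s)))) (zeroʳ _))) (zeroʳ _)))

  -- Multilinearity in the rows: taking `v` in two rows gives equal rows, so at most one row is
  -- replaced. This is both the induction step of `cauchy-binet` and the way to evaluate 2I plus a
  -- rank one matrix.
  Det-rank-one : ∀ {k} (M : Matrix k k) (u v : Row k) →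
    Det (λ i j → M i j + u i * v j) ≈ Det M + ∑ (λ i → u i * Det (put M i v))
  Det-rank-one {zero}  M u v = trans (trans (Det-empty _) (sym (Det-empty _)))
    (trans (sym (+-identityʳ _)) (+-congˡ (sym (∑-empty _))))
  Det-rank-one {suc k} M u v = begin
    Det (λ i j → M i j + u i * v j)
      ≈⟨ Det-suc _ ⟩
    ∑ (λ j → sg j * ((M zero j + u zero * v j) * Det (λ r s → M (suc r) (punchIn j s) + u (suc r) * v (punchIn j s))))
      ≈⟨ ∑-cong (λ j → *-congˡ (*-congˡ (Det-rank-one (minor j) (u ∘ suc) (v ∘ punchIn j)))) ⟩
    ∑ (λ j → sg j * ((M zero j + u zero * v j) * (Det (minor j) + E j)))
      ≈⟨ ∑-cong (λ j → solve 6 (λ s m u v d e → s :* ((m :+ u :* v) :* (d :+ e)) :=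
           (s :* (m :* d) :+ u :* (s :* (v :* d))) :+ (s :* (m :* e) :+ u :* (s :* (v :* e))))
           refl (sg j) (M zero j) (u zero) (v j) (Det (minor j)) (E j)) ⟩
    ∑ (λ j → (sg j * (M zero j * Det (minor j)) + u zero * (sg j * (v j * Det (minor j)))) +
             (sg j * (M zero j * E j) + u zero * (sg j * (v j * E j))))
      ≈⟨ trans (∑-+ _ _) (+-cong (trans (∑-+ _ _) (+-congˡ (∑-*ˡ _ _)))
                                 (trans (∑-+ _ _) (+-congˡ (∑-*ˡ _ _)))) ⟩
    (∑ (λ j → sg j * (M zero j * Det (minor j))) + u zero * ∑ (λ j → sg j * (v j * Det (minor j)))) +
    (∑ (λ j → sg j * (M zero j * E j)) + u zero * ∑ (λ j → sg j * (v j * E j)))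
      ≈⟨ +-cong (+-cong (sym (Det-suc M)) (*-congˡ (sym (Det-suc (put M zero v)))))
           (+-cong (expand (M zero)) (*-congˡ (trans (expand v) (∑-zero (λ i →
           trans (*-congˡ (Det-equal-rows (v ◂ put (M ∘ suc) i v) zero (suc i) (λ ())
             (λ t → reflexive (≡.cong (λ f → f t) (≡.sym (put-updates (M ∘ suc) i v))))))
             (zeroʳ _)))))) ⟩
    (Det M + u zero * Det (put M zero v)) +
    (∑ (λ i → u (suc i) * Det (M zero ◂ put (M ∘ suc) i v)) + u zero * 0#)
      ≈⟨ solve 4 (λ a b c d → (a :+ b) :+ (c :+ d :* con (+ 0)) := a :+ (b :+ c)) refl _ _ _ _ ⟩
    Det M + (u zero * Det (put M zero v) +
      ∑ (λ i → u (suc i) * Det (M zero ◂ put (M ∘ suc) i v)))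
      ≈⟨ +-congˡ (trans (+-congˡ (∑-cong (λ i → *-congˡ (Det-cong
           λ { zero t → refl ; (suc r) t → refl })))) (sym (∑-suc _))) ⟩
    Det M + ∑ (λ i → u i * Det (put M i v)) ∎
    where
    minor : Fin (suc k) → Matrix k k
    minor j r s = M (suc r) (punchIn j s)
    E : Row (suc k)
    E j = ∑ (λ i → u (suc i) * Det (put (minor j) i (v ∘ punchIn j)))
    expand : ∀ a → ∑ (λ j → sg j * (a j * E j)) ≈
                   ∑ (λ i → u (suc i) * Det (a ◂ put (M ∘ suc) i v))
    expand a = begin
      ∑ (λ j → sg j * (a j * E j))
        ≈⟨ ∑-cong (λ j → trans (sym (*-assoc _ _ _)) (sym (∑-*ˡ _ _))) ⟩
      ∑ (λ j → ∑ (λ i → (sg j * a j) * (u (suc i) * Det (put (minor j) i (v ∘ punchIn j)))))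
        ≈⟨ ∑-swap _ ⟩
      ∑ (λ i → ∑ (λ j → (sg j * a j) * (u (suc i) * Det (put (minor j) i (v ∘ punchIn j)))))
        ≈⟨ ∑-cong (λ i → trans (∑-cong (λ j → trans
             (solve 4 (λ s a u d → (s :* a) :* (u :* d) := u :* (s :* (a :* d))) refl _ _ _ _)
             (*-congˡ (*-congˡ (*-congˡ (Det-cong (λ r s → reflexive
               (≡.cong (λ f → f s) (≡.sym (put-map (λ f → f ∘ punchIn j) (M ∘ suc) i v r))))))))))
             (trans (∑-*ˡ _ _) (*-congˡ (sym (Det-suc _))))) ⟩
      ∑ (λ i → u (suc i) * Det (a ◂ put (M ∘ suc) i v)) ∎

  -- The new row is moved to the top past `i` others, one sign for each swap, so that it can be
  -- expanded along.
  Det-put : ∀ {k} (M : Matrix (suc k) (suc k)) i (v : Row (suc k)) →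
    Det (put M i v) ≈ sg i * Det (v ◂ (λ r → M (punchIn i r)))
  Det-put M zero v = trans (Det-cong λ { zero t → refl ; (suc r) t → refl })
    (sym (*-identityˡ _))
  Det-put {suc k} M (suc i) v = begin
    Det (put M (suc i) v)
      ≈⟨ trans (Det-suc _) (∑-cong (λ j → *-congˡ (*-congˡ (trans
           (Det-cong (λ r s → reflexive (≡.cong (λ f → f s)
             (put-map (λ f → f ∘ punchIn j) (M ∘ suc) i v r))))
           (Det-put (λ r s → M (suc r) (punchIn j s)) i (v ∘ punchIn j)))))) ⟩
    ∑ (λ j → sg j * (M zero j * (sg i * D j)))
      ≈⟨ trans (∑-cong (λ j → solve 4 (λ s m i d → s :* (m :* (i :* d)) := i :* (s :* (m :* d)))
           refl _ _ _ _)) (∑-*ˡ _ _) ⟩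
    sg i * ∑ (λ j → sg j * (M zero j * D j))
      ≈⟨ *-congˡ (trans (∑-cong (λ j → *-congˡ (*-congˡ (Det-cong
           λ { zero t → refl ; (suc r) t → refl })))) (sym (Det-suc _))) ⟩
    sg i * Det (M zero ◂ v ◂ L)
      ≈⟨ *-congˡ (Det-swap L (M zero) v) ⟩
    sg i * - Det (v ◂ M zero ◂ L)
      ≈⟨ solve 2 (λ a b → a :* :- b := :- a :* b) refl _ _ ⟩
    - sg i * Det (v ◂ M zero ◂ L)
      ≈⟨ *-congˡ (Det-cong λ { zero t → refl ; (suc zero) t → refl ; (suc (suc r)) t → refl }) ⟩
    - sg i * Det (v ◂ (λ r → M (punchIn (suc i) r))) ∎
    where
    L : Matrix k (2 ℕ.+ k)
    L r = M (suc (punchIn i r))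
    D : Row (2 ℕ.+ k)
    D j = Det ((v ∘ punchIn j) ◂ (λ r s → M (suc (punchIn i r)) (punchIn j s)))

-- The Cauchy-Binet formula, multiplicativity and transposition.

module CauchyBinet {c ℓ} (R : CommutativeRing c ℓ) where
  open CommutativeRing R hiding (zero)
  open import Relation.Binary.Reasoning.Setoid setoid
  open FromℤHom R
  open Determinant R

  ∑-δʳ : ∀ {n} (f : Row n) j → ∑ (λ i → f i * δ i j) ≈ f j
  ∑-δʳ f zero = trans (∑-suc _) (trans
    (+-cong (*-identityʳ _) (∑-zero (λ i → zeroʳ _))) (+-identityʳ _))
  ∑-δʳ f (suc j) = trans (∑-suc _) (trans
    (+-cong (zeroʳ _) (∑-δʳ (f ∘ suc) j)) (+-identityˡ _))

  Det-first-row : ∀ {k} (M : Matrix (suc k) (suc k)) → (∀ j → M zero (suc j) ≈ 0#) →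
    Det M ≈ M zero zero * Det (λ r s → M (suc r) (suc s))
  Det-first-row M M₀≈0 = begin
    Det M
      ≈⟨ trans (Det-suc M) (∑-suc _) ⟩
    1# * (M zero zero * Det (λ r s → M (suc r) (suc s))) + ∑ _
      ≈⟨ +-cong (*-identityˡ _) (∑-zero (λ j →
           trans (*-congˡ (trans (*-congʳ (M₀≈0 j)) (zeroˡ _))) (zeroʳ _))) ⟩
    M zero zero * Det (λ r s → M (suc r) (suc s)) + 0#
      ≈⟨ +-identityʳ _ ⟩
    M zero zero * Det (λ r s → M (suc r) (suc s)) ∎

  Det-zero-column : ∀ {k} (M : Matrix (suc k) (suc k)) → (∀ i → M i zero ≈ 0#) → Det M ≈ 0#
  Det-zero-column {k} M M≈0 = trans (Det-suc M) (∑-zero (term k M M≈0))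
    where
    term : ∀ k (M : Matrix (suc k) (suc k)) → (∀ i → M i zero ≈ 0#) →
           ∀ j → sg j * (M zero j * Det (λ r s → M (suc r) (punchIn j s))) ≈ 0#
    term k M M≈0 zero = trans (*-congˡ (trans (*-congʳ (M≈0 zero)) (zeroˡ _))) (zeroʳ _)
    term (suc k) M M≈0 (suc j) = trans (*-congˡ (trans (*-congˡ
      (Det-zero-column (λ r s → M (suc r) (punchIn (suc j) s)) (M≈0 ∘ suc))) (zeroʳ _))) (zeroʳ _)

  Det-first-column : ∀ {k} (M : Matrix (suc k) (suc k)) → (∀ i → M (suc i) zero ≈ 0#) →
    Det M ≈ M zero zero * Det (λ r s → M (suc r) (suc s))
  Det-first-column {k} M M≈0 = begin
    Det M
      ≈⟨ trans (Det-suc M) (∑-suc _) ⟩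
    1# * (M zero zero * Det (λ r s → M (suc r) (suc s))) + ∑ _
      ≈⟨ +-cong (*-identityˡ _) (∑-zero (term k M M≈0)) ⟩
    M zero zero * Det (λ r s → M (suc r) (suc s)) + 0#
      ≈⟨ +-identityʳ _ ⟩
    M zero zero * Det (λ r s → M (suc r) (suc s)) ∎
    where
    term : ∀ k (M : Matrix (suc k) (suc k)) → (∀ i → M (suc i) zero ≈ 0#) →
           ∀ j → sg (suc j) * (M zero (suc j) * Det (λ r s → M (suc r) (punchIn (suc j) s))) ≈ 0#
    term (suc k) M M≈0 j = trans (*-congˡ (trans (*-congˡ
      (Det-zero-column (λ r s → M (suc r) (punchIn (suc j) s)) M≈0)) (zeroʳ _))) (zeroʳ _)

  -- The powers of `x` enter as any `p` with their recursion, so that `pow2` and the constant 1 both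
  -- fit as they are.
  Det-scalar : ∀ x (p : ℕ → Carrier) → p 0 ≈ 1# → (∀ k → p (suc k) ≈ x * p k) →
    ∀ k → Det {k} (λ i j → x * δ i j) ≈ p k
  Det-scalar x p p₀ p₊ zero    = trans (Det-empty _) (sym p₀)
  Det-scalar x p p₀ p₊ (suc k) = trans (Det-first-row (λ i j → x * δ i j) (λ j → zeroʳ x))
    (trans (*-cong (*-identityʳ x) (Det-scalar x p p₀ p₊ k)) (sym (p₊ k)))

  Det-δ : ∀ k → Det {k} δ ≈ 1#
  Det-δ k = trans (Det-cong (λ i j → sym (*-identityˡ _)))
    (Det-scalar 1# (λ _ → 1#) refl (λ _ → sym (*-identityˡ 1#)) k)

  2# : Carrier
  2# = 1# + 1#

  Det-2δ : ∀ k → Det {k} (λ i j → 2# * δ i j) ≈ pow2 R k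
  Det-2δ = Det-scalar 2# (pow2 R) refl (λ _ → refl)

  -- The matrix determinant lemma for 2I. Row `i` of 2I replaced by `w` leaves determinant `w i`
  -- times a power of 2. The size is given by an equation because it will be `cut A`, which does not
  -- reduce to a successor.
  Det-2δ+rank-one : ∀ k {n} → n ≡ suc k → (u w : Row n) →
    Det (λ i j → 2# * δ i j + u i * w j) ≈ pow2 R k * (2# + ∑ (λ i → u i * w i))
  Det-2δ+rank-one k ≡.refl u w = begin
    Det (λ i j → 2# * δ i j + u i * w j)
      ≈⟨ Det-rank-one (λ i j → 2# * δ i j) u w ⟩
    Det {suc k} (λ i j → 2# * δ i j) + ∑ (λ i → u i * Det (put (λ i j → 2# * δ i j) i w))
      ≈⟨ +-cong (Det-2δ (suc k)) (∑-cong (λ i → trans (*-congˡ (replaced k i w)) (sym (*-assoc _ _ _)))) ⟩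
    2# * pow2 R k + ∑ (λ i → (u i * w i) * pow2 R k)
      ≈⟨ +-cong (*-comm _ _) (trans (∑-cong (λ i → *-comm _ _)) (∑-*ˡ _ _)) ⟩
    pow2 R k * 2# + pow2 R k * ∑ (λ i → u i * w i)
      ≈⟨ distribˡ _ _ _ ⟨
    pow2 R k * (2# + ∑ (λ i → u i * w i)) ∎
    where
    replaced : ∀ k i (w : Row (suc k)) → Det (put (λ i j → 2# * δ i j) i w) ≈ w i * pow2 R k
    replaced k zero w = trans (Det-first-column _ (λ i → zeroʳ _)) (*-congˡ (Det-2δ k))
    replaced (suc k) (suc i) w = begin
      Det (put (λ i j → 2# * δ i j) (suc i) w)
        ≈⟨ Det-first-row _ (λ j → zeroʳ _) ⟩
      (2# * 1#) * Det (λ r s → put (λ i j → 2# * δ (suc i) j) i w r (suc s))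
        ≈⟨ *-cong (*-identityʳ _) (Det-cong (λ r s → reflexive (≡.cong (λ f → f s)
             (put-map (λ f → f ∘ suc) (λ i j → 2# * δ (suc i) j) i w r)))) ⟩
      2# * Det (put (λ i j → 2# * δ i j) i (w ∘ suc))
        ≈⟨ *-congˡ (replaced k i (w ∘ suc)) ⟩
      2# * (w (suc i) * pow2 R k)
        ≈⟨ solve 3 (λ a b c → a :* (b :* c) := b :* (a :* c)) refl _ _ _ ⟩
      w (suc i) * pow2 R (suc k) ∎

  opaque
    ∑ˢ : ∀ {m} → (Subset m → Carrier) → Carrier
    ∑ˢ {zero}  f = f []
    ∑ˢ {suc m} f = ∑ˢ (λ A → f (true ∷ A)) + ∑ˢ (λ A → f (false ∷ A))

    ∑ˢ-[] : (f : Subset 0 → Carrier) → ∑ˢ f ≈ f []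
    ∑ˢ-[] f = refl

    ∑ˢ-∷ : ∀ {m} (f : Subset (suc m) → Carrier) →
      ∑ˢ f ≈ ∑ˢ (λ A → f (true ∷ A)) + ∑ˢ (λ A → f (false ∷ A))
    ∑ˢ-∷ f = refl

    ∑ˢ-cong : ∀ {m} {f g : Subset m → Carrier} → (∀ A → f A ≈ g A) → ∑ˢ f ≈ ∑ˢ g
    ∑ˢ-cong {zero}  f≈g = f≈g []
    ∑ˢ-cong {suc m} f≈g = +-cong (∑ˢ-cong (λ A → f≈g (true ∷ A))) (∑ˢ-cong (λ A → f≈g (false ∷ A)))

    ∑ˢ-+ : ∀ {m} (f g : Subset m → Carrier) → ∑ˢ (λ A → f A + g A) ≈ ∑ˢ f + ∑ˢ g
    ∑ˢ-+ {zero}  f g = refl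
    ∑ˢ-+ {suc m} f g = trans (+-cong (∑ˢ-+ {m} _ _) (∑ˢ-+ {m} _ _))
      (solve 4 (λ a b x y → (a :+ b) :+ (x :+ y) := (a :+ x) :+ (b :+ y)) refl _ _ _ _)

    ∑ˢ-*ˡ : ∀ {m} x (f : Subset m → Carrier) → ∑ˢ (λ A → x * f A) ≈ x * ∑ˢ f
    ∑ˢ-*ˡ {zero}  x f = refl
    ∑ˢ-*ˡ {suc m} x f = trans (+-cong (∑ˢ-*ˡ {m} x _) (∑ˢ-*ˡ {m} x _)) (sym (distribˡ x _ _))

  ∑ˢ-zero : ∀ {m} {f : Subset m → Carrier} → (∀ A → f A ≈ 0#) → ∑ˢ f ≈ 0#
  ∑ˢ-zero f≈0 = trans (∑ˢ-cong (λ A → trans (f≈0 A) (sym (zeroˡ 0#)))) (trans (∑ˢ-*ˡ 0# _) (zeroˡ _))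

  ∑-∑ˢ-swap : ∀ {n m} (x : Row n) (f : Fin n → Subset m → Carrier) →
    ∑ (λ i → x i * ∑ˢ (f i)) ≈ ∑ˢ (λ A → ∑ (λ i → x i * f i A))
  ∑-∑ˢ-swap {zero}  x f = trans (∑-empty _) (sym (∑ˢ-zero (λ A → ∑-empty _)))
  ∑-∑ˢ-swap {suc n} x f = trans (∑-suc _) (trans (+-cong (sym (∑ˢ-*ˡ _ _)) (∑-∑ˢ-swap (x ∘ suc) (f ∘ suc)))
    (trans (sym (∑ˢ-+ _ _)) (∑ˢ-cong (λ A → sym (∑-suc _)))))

  ∑ˢ-single : ∀ {m} (f : Subset m → Carrier) B → (∀ A → A ≢ B → f A ≈ 0#) → ∑ˢ f ≈ f B
  ∑ˢ-single f []          f≈0 = ∑ˢ-[] f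
  ∑ˢ-single f (true  ∷ B) f≈0 = trans (∑ˢ-∷ f) (trans
    (+-cong (∑ˢ-single (λ A → f (true ∷ A)) B (λ A A≢B → f≈0 (true ∷ A) (A≢B ∘ ∷-injectiveʳ)))
            (∑ˢ-zero (λ A → f≈0 (false ∷ A) (λ ()))))
    (+-identityʳ _))
  ∑ˢ-single f (false ∷ B) f≈0 = trans (∑ˢ-∷ f) (trans
    (+-cong (∑ˢ-zero (λ A → f≈0 (true ∷ A) (λ ())))
            (∑ˢ-single (λ A → f (false ∷ A)) B (λ A A≢B → f≈0 (false ∷ A) (A≢B ∘ ∷-injectiveʳ))))
    (+-identityˡ _))

  -- The minor of C with the rows outside A and all columns; it is 0 unless
  -- the number of these rows is k.
  minor : ∀ {m k} → Subset m → Matrix m k → Carrier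
  minor             (true  ∷ A) C = minor A (C ∘ suc)
  minor {k = zero}  []          C = 1#
  minor {k = suc k} []          C = 0#
  minor {k = zero}  (false ∷ A) C = 0#
  minor {k = suc k} (false ∷ A) C =
    ∑ (λ i → sg i * (C zero i * minor A (λ e r → C (suc e) (punchIn i r))))

  minor≈0 : ∀ {m k} (A : Subset m) (C : Matrix m k) → cut A ≢ k → minor A C ≈ 0#
  minor≈0 {k = zero}  []          C cut≢k = ⊥-elim (cut≢k ≡.refl)
  minor≈0 {k = suc k} []          C cut≢k = refl
  minor≈0             (true  ∷ A) C cut≢k = minor≈0 A (C ∘ suc) cut≢k
  minor≈0 {k = zero}  (false ∷ A) C cut≢k = refl
  minor≈0 {k = suc k} (false ∷ A) C cut≢k = ∑-zero (λ i → trans (*-congˡ (trans (*-congˡ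
    (minor≈0 A _ (cut≢k ∘ ≡.cong suc))) (zeroʳ _))) (zeroʳ _))

  minor≈Det : ∀ {m} (A : Subset m) (C : Matrix m (cut A)) → minor A C ≈ Det (C ∘ cutEdge A)
  minor≈Det []          C = sym (Det-empty _)
  minor≈Det (true  ∷ A) C = minor≈Det A (C ∘ suc)
  minor≈Det (false ∷ A) C = trans (∑-cong (λ i → *-congˡ {x = sg i} (*-congˡ (minor≈Det A _)))) (sym (Det-suc _))

  minor-none : ∀ {m} (C : Matrix m m) → minor (replicate m false) C ≈ Det C
  minor-none {zero}  C = sym (Det-empty _)
  minor-none {suc m} C = trans (∑-cong (λ i → *-congˡ {x = sg i} (*-congˡ (minor-none _)))) (sym (Det-suc _))

  -- Induction on the number of rows: splitting off row 0 is a rank one update. The unmodified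
  -- determinant gives the sets whose minors avoid row 0, the correction gives those that use it.
  -- The case `k > m`, where both sides vanish, is included and is needed for `cut≤t`.
  cauchy-binet : ∀ {m k} (d : Row m) (C C′ : Matrix m k) →
    Det (λ i j → ∑ (λ e → d e * (C e i * C′ e j))) ≈
    ∑ˢ (λ A → weight R d A * (minor A C * minor A C′))
  cauchy-binet {zero} {zero}  d C C′ = trans (Det-empty _) (sym (trans (∑ˢ-[] _)
    (trans (*-identityˡ _) (*-identityˡ _))))
  cauchy-binet {zero} {suc k} d C C′ = trans (Det-zero-column _ (λ i → ∑-empty _))
    (sym (trans (∑ˢ-[] _) (trans (*-identityˡ _) (zeroˡ _))))
  cauchy-binet {suc m} {k} d C C′ = begin
    Det (λ i j → ∑ (λ e → d e * (C e i * C′ e j)))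
      ≈⟨ Det-cong (λ i j → trans (∑-suc _) (trans (+-comm _ _) (+-congˡ (sym (*-assoc _ _ _))))) ⟩
    Det (λ i j → tailProduct C C′ i j + (d zero * C zero i) * C′ zero j)
      ≈⟨ Det-rank-one (tailProduct C C′) (λ i → d zero * C zero i) (C′ zero) ⟩
    Det (tailProduct C C′) + ∑ (λ i → (d zero * C zero i) * Det (put (tailProduct C C′) i (C′ zero)))
      ≈⟨ +-cong (trans (cauchy-binet (d ∘ suc) (C ∘ suc) (C′ ∘ suc))
                       (∑ˢ-cong (λ A → *-congʳ (sym (*-identityˡ _)))))
                (first-row-used C C′) ⟩
    ∑ˢ (λ A → weight R d (true  ∷ A) * (minor (true  ∷ A) C * minor (true  ∷ A) C′)) +
    ∑ˢ (λ A → weight R d (false ∷ A) * (minor (false ∷ A) C * minor (false ∷ A) C′))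
      ≈⟨ ∑ˢ-∷ _ ⟨
    ∑ˢ (λ A → weight R d A * (minor A C * minor A C′)) ∎
    where
    tailProduct : ∀ {k} (C C′ : Matrix (suc m) k) → Matrix k k
    tailProduct C C′ i j = ∑ (λ e → d (suc e) * (C (suc e) i * C′ (suc e) j))
    first-row-used : ∀ {k} (C C′ : Matrix (suc m) k) →
      ∑ (λ i → (d zero * C zero i) * Det (put (tailProduct C C′) i (C′ zero))) ≈
      ∑ˢ (λ A → weight R d (false ∷ A) * (minor (false ∷ A) C * minor (false ∷ A) C′))
    first-row-used {zero}  C C′ = trans (∑-empty _)
      (sym (∑ˢ-zero (λ A → trans (*-congˡ (zeroˡ _)) (zeroʳ _))))
    -- Moving the replaced row to the top and expanding it gives the Laplace expansion of the minor
    -- of `C′`. The outer sum over `i`, with the sign from `Det-put`, is that of the minor of `C`.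
    first-row-used {suc k} C C′ = begin
      ∑ (λ i → (d zero * a i) * Det (put M i b))
        ≈⟨ ∑-cong (λ i → *-congˡ (trans (Det-put M i b) (*-congˡ (trans (Det-suc _)
             (trans (∑-cong (λ j → trans (*-congˡ (*-congˡ
                (cauchy-binet (d ∘ suc) (drop C i) (drop C′ j)))) (sym (*-assoc _ _ _))))
             (∑-∑ˢ-swap _ _)))))) ⟩
      ∑ (λ i → (d zero * a i) * (sg i * ∑ˢ (λ A → ∑ (λ j →
        (sg j * b j) * (w A * (minor A (drop C i) * minor A (drop C′ j)))))))
        ≈⟨ ∑-cong (λ i → trans (sym (*-assoc _ _ _)) (*-congˡ (∑ˢ-cong (λ A → trans (∑-cong (λ j →
             solve 5 (λ s c w p q → (s :* c) :* (w :* (p :* q)) := (w :* p) :* (s :* (c :* q)))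
               refl _ _ _ _ _)) (∑-*ˡ _ _))))) ⟩
      ∑ (λ i → ((d zero * a i) * sg i) * ∑ˢ (λ A → (w A * minor A (drop C i)) * minor (false ∷ A) C′))
        ≈⟨ ∑-∑ˢ-swap _ _ ⟩
      ∑ˢ (λ A → ∑ (λ i → ((d zero * a i) * sg i) * ((w A * minor A (drop C i)) * minor (false ∷ A) C′)))
        ≈⟨ ∑ˢ-cong (λ A → trans (∑-cong (λ i →
             solve 6 (λ d c s w p q → ((d :* c) :* s) :* ((w :* p) :* q) :=
                                      ((d :* w) :* q) :* (s :* (c :* p))) refl _ _ _ _ _ _))
             (trans (∑-*ˡ _ _)
                (solve 4 (λ d w q p → ((d :* w) :* q) :* p := (d :* w) :* (p :* q)) refl _ _ _ _))) ⟩
      ∑ˢ (λ A → (d zero * w A) * (minor (false ∷ A) C * minor (false ∷ A) C′)) ∎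
      where
      a b : Row (suc k)
      a = C zero
      b = C′ zero
      M : Matrix (suc k) (suc k)
      M = tailProduct C C′
      w : Subset m → Carrier
      w = weight R (d ∘ suc)
      drop : Matrix (suc m) (suc k) → Fin (suc k) → Matrix m k
      drop C i e r = C (suc e) (punchIn i r)

  weight-one : ∀ {m} (A : Subset m) → weight R (λ _ → 1#) A ≈ 1#
  weight-one []          = refl
  weight-one (true  ∷ A) = trans (*-identityˡ _) (weight-one A)
  weight-one (false ∷ A) = trans (*-identityˡ _) (weight-one A)

  -- Cauchy-Binet with unit weights: for square matrices only the minor with all rows has the right
  -- size.
  Det-*ᵗ : ∀ {k} (C C′ : Matrix k k) → Det (λ i j → ∑ (λ e → C e i * C′ e j)) ≈ Det C * Det C′
  Det-*ᵗ {k} C C′ = begin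
    Det (λ i j → ∑ (λ e → C e i * C′ e j))
      ≈⟨ Det-cong (λ i j → ∑-cong (λ e → sym (*-identityˡ _))) ⟩
    Det (λ i j → ∑ (λ e → 1# * (C e i * C′ e j)))
      ≈⟨ cauchy-binet (λ _ → 1#) C C′ ⟩
    ∑ˢ (λ A → weight R (λ _ → 1#) A * (minor A C * minor A C′))
      ≈⟨ ∑ˢ-single _ (replicate k false) (λ A A≢none → trans (*-congˡ (trans
           (*-congʳ (minor≈0 A C (A≢none ∘ cut-all A))) (zeroˡ _))) (zeroʳ _)) ⟩
    weight R (λ _ → 1#) (replicate k false) * (minor (replicate k false) C * minor (replicate k false) C′)
      ≈⟨ trans (*-congʳ (weight-one (replicate k false))) (*-identityˡ _) ⟩
    minor (replicate k false) C * minor (replicate k false) C′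
      ≈⟨ *-cong (minor-none C) (minor-none C′) ⟩
    Det C * Det C′ ∎

  -- `Det-*ᵗ` already has a transposed left factor on one side only; taking the identity as the
  -- other factor yields the claim.
  Det-transpose : ∀ {k} (C : Matrix k k) → Det (λ i j → C j i) ≈ Det C
  Det-transpose {k} C = begin
    Det (λ i j → C j i)                     ≈⟨ Det-cong (λ i j → ∑-δʳ (λ e → C e i) j) ⟨
    Det (λ i j → ∑ (λ e → C e i * δ e j))   ≈⟨ Det-*ᵗ C δ ⟩
    Det C * Det {k} δ                       ≈⟨ trans (*-congˡ (Det-δ k)) (*-identityʳ _) ⟩
    Det C                                   ∎

  Det-* : ∀ {k} (A B : Matrix k k) → Det (λ i j → ∑ (λ e → A i e * B e j)) ≈ Det A * Det B
  Det-* A B = trans (Det-*ᵗ (λ e i → A i e) B) (*-congʳ (Det-transpose A))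

  Det-equal-columns : ∀ {k} (M : Matrix k k) i j → i ≢ j → (∀ t → M t i ≈ M t j) → Det M ≈ 0#
  Det-equal-columns M i j i≢j eq = trans (sym (Det-transpose M))
    (Det-equal-rows (λ r s → M s r) i j i≢j eq)

  minor-equal-columns : ∀ {m k} (A : Subset m) (C : Matrix m k) i j → i ≢ j →
    (∀ e → lookup A e ≡ false → C e i ≈ C e j) → minor A C ≈ 0#
  minor-equal-columns {k = k} A C i j i≢j eq with cut A ℕ.≟ k
  ... | no  cut≢k  = minor≈0 A C cut≢k
  ... | yes ≡.refl = trans (minor≈Det A C)
    (Det-equal-columns (C ∘ cutEdge A) i j i≢j (λ p → eq (cutEdge A p) (cutEdge-∉ A p)))

-- Unimodular integer matrices.

private module ℤDet = Determinant ℤₚ.+-*-commutativeRing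
private module ℤCB = CauchyBinet ℤₚ.+-*-commutativeRing

∣i∣≡1⇒i*i≡1 : ∀ i → ℤ.∣ i ∣ ≡ 1 → i ℤ.* i ≡ + 1
∣i∣≡1⇒i*i≡1 (+ 1)    eq = ≡.refl
∣i∣≡1⇒i*i≡1 -[1+ 0 ] eq = ≡.refl

i*j≡1⇒i*i≡1 : ∀ i j → i ℤ.* j ≡ + 1 → i ℤ.* i ≡ + 1
i*j≡1⇒i*i≡1 i j ij≡1 = ∣i∣≡1⇒i*i≡1 i (ℕₚ.m*n≡1⇒m≡1 ℤ.∣ i ∣ ℤ.∣ j ∣
  (≡.trans (≡.sym (ℤₚ.∣i*j∣≡∣i∣*∣j∣ i j)) (≡.cong ℤ.∣_∣ ij≡1)))

module IntegerMatrices {c ℓ} (R : CommutativeRing c ℓ) where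
  open CommutativeRing R hiding (zero)
  open FromℤHom R
  open Determinant R

  φ-sgn : ∀ n → φ (sgn ℤₚ.+-*-commutativeRing n) ≈ sgn R n
  φ-sgn zero    = refl
  φ-sgn (suc n) = trans (φ-neg (sgn ℤₚ.+-*-commutativeRing n)) (-‿cong (φ-sgn n))

  φ-∑ : ∀ {n} (f : ℤDet.Row n) → φ (ℤDet.∑ f) ≈ ∑ (φ ∘ f)
  φ-∑ {zero}  f = trans (reflexive (≡.cong φ (ℤDet.∑-empty f))) (sym (∑-empty _))
  φ-∑ {suc n} f = trans (reflexive (≡.cong φ (ℤDet.∑-suc f)))
    (trans (φ-+ (f zero) _) (trans (+-congˡ (φ-∑ (f ∘ suc))) (sym (∑-suc _))))

  φ-Det : ∀ {k} (M : ℤDet.Matrix k k) → φ (ℤDet.Det M) ≈ Det (λ i j → φ (M i j))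
  φ-Det {zero}  M = trans (reflexive (≡.cong φ (ℤDet.Det-empty M))) (sym (Det-empty _))
  φ-Det {suc k} M = trans (reflexive (≡.cong φ (ℤDet.Det-suc M))) (trans (φ-∑ _) (trans
    (∑-cong (λ j → trans (φ-* (ℤDet.sg j) _) (*-cong (φ-sgn (toℕ j))
      (trans (φ-* (M zero j) _) (*-congˡ (φ-Det (λ r s → M (suc r) (punchIn j s))))))))
    (sym (Det-suc _))))

  -- The two integer determinants multiply to 1, so the one of `M` is 1 or -1; its square is 1
  -- already before `φ` is applied.
  unimodular : ∀ {k} (M N : ℤDet.Matrix k k) →
    (∀ i j → ℤDet.∑ (λ e → M i e ℤ.* N e j) ≡ ℤDet.δ i j) →
    Det (λ i j → φ (M i j)) * Det (λ i j → φ (M i j)) ≈ 1#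
  unimodular {k} M N MN≡δ = trans (sym (*-cong (φ-Det M) (φ-Det M)))
    (trans (sym (φ-* (ℤDet.Det M) (ℤDet.Det M))) (reflexive (≡.cong φ
      (i*j≡1⇒i*i≡1 (ℤDet.Det M) (ℤDet.Det N)
        (≡.trans (≡.sym (ℤCB.Det-* M N)) (≡.trans (ℤDet.Det-cong MN≡δ) (ℤCB.Det-δ k)))))))

-- Incidence vectors and side functions of the deleted edges.

-- The edges f of a tree, with endpoints x f and y f; `side e` tells apart the
-- two components left by the removal of e.
module Sides {V : Set} {m} (x y : Fin m → V) (side : Fin m → V → Bool)
  (side-x : ∀ e → side e (x e) ≡ true) (side-y : ∀ e → side e (y e) ≡ false)
  (side-xy : ∀ {e f} → e ≢ f → side e (x f) ≡ side e (y f)) where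

  -- c v is the index of the representative of the component of v in the forest A.
  module Forest {t} (A : Subset m) (T : Fin (suc t) → V) (c : V → Fin (suc t))
    (side-c : ∀ {e} → lookup A e ≡ false → ∀ v → side e (T (c v)) ≡ side e v) where

    module Incidence {a ℓ} (R : CommutativeRing a ℓ) where
      open CommutativeRing R hiding (zero)
      open import Algebra.Properties.Ring ring
      open import Relation.Binary.Reasoning.Setoid setoid
      open FromℤHom R
      open Determinant R
      open CauchyBinet R

      δ-sym : ∀ {n} (i j : Fin n) → δ i j ≈ δ j i
      δ-sym zero    zero    = refl
      δ-sym zero    (suc j) = refl
      δ-sym (suc i) zero    = refl
      δ-sym (suc i) (suc j) = δ-sym i j

      δ-≡ : ∀ {n} {i j : Fin n} → i ≡ j → δ i j ≈ 1#
      δ-≡ {i = i} {j} i≡j = reflexive (≡.cong ⟦_⟧ (dec-true (i ≟ j) i≡j))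

      δ-≢ : ∀ {n} {i j : Fin n} → i ≢ j → δ i j ≈ 0#
      δ-≢ {i = i} {j} i≢j = reflexive (≡.cong ⟦_⟧ (dec-false (i ≟ j) i≢j))

      -- The signed incidence matrix of the contracted tree, with the components as vertices and the
      -- deleted edges as edges.
      ends : Fin (cut A) → Fin (suc t) → Carrier
      ends p i = δ (c (x (cutEdge A p))) i - δ (c (y (cutEdge A p))) i

      sideOf : Fin (cut A) → V → Bool
      sideOf p = side (cutEdge A p)

      ∑-ends : ∀ p (g : Fin (suc t) → Carrier) →
        ∑ (λ i → ends p i * g i) ≈ g (c (x (cutEdge A p))) - g (c (y (cutEdge A p)))
      ∑-ends p g = trans (∑-cong (λ i → [y-z]x≈yx-zx _ _ _))
        (trans (∑-minus _ _) (+-cong (∑-δ _ g) (-‿cong (∑-δ _ g))))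

      -- By `side-c` the representatives may be exchanged for the ends of edge `p` themselves, and
      -- the side with respect to `q` changes along `p` only if `p` is `q`.
      ∑-ends-side : (g : Bool → Carrier) → ∀ p q →
        ∑ (λ i → ends p i * g (sideOf q (T i))) ≈ (g true - g false) * δ p q
      ∑-ends-side g p q = trans (∑-ends p (λ i → g (sideOf q (T i))))
        (trans (reflexive (≡.cong₂ (λ a b → g a - g b) (side-c (cutEdge-∉ A q) _) (side-c (cutEdge-∉ A q) _)))
               (cases (p ≟ q)))
        where
        cases : Dec (p ≡ q) → g (sideOf q (x (cutEdge A p))) - g (sideOf q (y (cutEdge A p)))
                              ≈ (g true - g false) * δ p q
        cases (yes ≡.refl) = trans
          (reflexive (≡.cong₂ (λ a b → g a - g b) (side-x (cutEdge A p)) (side-y (cutEdge A p))))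
          (sym (trans (*-congˡ (δ-≡ {i = p} ≡.refl)) (*-identityʳ _)))
        cases (no p≢q) = trans
          (trans (+-congʳ (reflexive (≡.cong g (side-xy (p≢q ∘ ≡.sym ∘ cutEdge-injective A)))))
                 (-‿inverseʳ _))
          (sym (trans (*-congˡ (δ-≢ p≢q)) (zeroʳ _)))

      -- The signed path matrix: nonzero exactly if edge `q` separates `T (suc i)` from the base
      -- vertex `T zero`. It inverts the incidence matrix without column zero.
      relSide : Fin (cut A) → Fin t → Carrier
      relSide q i = ⟦ sideOf q (T (suc i)) ⟧ - ⟦ sideOf q (T zero) ⟧

      -- The normalised side function vanishes at `T zero`, so the dropped column can be restored;
      -- the normalising constant then cancels between the two ends of `p`.
      ends-relSide : ∀ p q → ∑ (λ i → ends p (suc i) * relSide q i) ≈ δ p q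
      ends-relSide p q = begin
        ∑ (λ i → ends p (suc i) * (g (suc i) - g zero))
          ≈⟨ +-identityˡ _ ⟨
        0# + ∑ (λ i → ends p (suc i) * (g (suc i) - g zero))
          ≈⟨ +-congʳ (trans (*-congˡ (-‿inverseʳ _)) (zeroʳ _)) ⟨
        ends p zero * (g zero - g zero) + ∑ (λ i → ends p (suc i) * (g (suc i) - g zero))
          ≈⟨ ∑-suc _ ⟨
        ∑ (λ i → ends p i * (g i - g zero))
          ≈⟨ ∑-ends p (λ i → g i - g zero) ⟩
        (g (c (x e)) - g zero) - (g (c (y e)) - g zero)
          ≈⟨ solve 3 (λ a b c → (a :- c) :- (b :- c) := a :- b) refl _ _ _ ⟩
        g (c (x e)) - g (c (y e))
          ≈⟨ ∑-ends p g ⟨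
        ∑ (λ i → ends p i * g i)
          ≈⟨ ∑-ends-side ⟦_⟧ p q ⟩
        (1# - 0#) * δ p q
          ≈⟨ solve 1 (λ d → (con (+ 1) :- con (+ 0)) :* d := d) refl _ ⟩
        δ p q ∎
        where
        e = cutEdge A p
        g : Fin (suc t) → Carrier
        g i = ⟦ sideOf q (T i) ⟧

      -- The factor 2, the source of all powers of 2 in the minors, is the jump of `spin` from -1 to
      -- 1 across an edge.
      ends-spin : ∀ p q → ∑ (λ i → spin (sideOf p (T i)) * ends q i) ≈ 2# * δ p q
      ends-spin p q = trans (∑-cong (λ i → *-comm _ _)) (trans (∑-ends-side spin q p)
        (*-cong (+-congˡ (-‿involutive 1#)) (δ-sym q p)))

    module ℤI = Incidence ℤₚ.+-*-commutativeRing

    -- The identity matrix factors through Fin t.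
    cut≤t : cut A ℕ.≤ t
    cut≤t with cut A ℕ.≤? t
    ... | yes le = le
    ... | no ¬le = ⊥-elim (1≢0 (≡.trans (≡.sym (ℤCB.Det-δ (cut A))) (≡.trans
        (ℤDet.Det-cong (λ p q → ≡.trans (≡.sym (ℤI.ends-relSide p q))
          (ℤDet.∑-cong (λ i → ≡.sym (ℤₚ.*-identityˡ _)))))
        (≡.trans (ℤCB.cauchy-binet (λ _ → + 1) (λ i p → ℤI.ends p (suc i)) (λ i q → ℤI.relSide q i))
          (ℤCB.∑ˢ-zero (λ B → ≡.trans (≡.cong (λ z → w B ℤ.* (z ℤ.* ℤCB.minor B (λ i q → ℤI.relSide q i)))
              (ℤCB.minor≈0 B _ (λ eq → ¬le (≡.subst (ℕ._≤ t) eq (cut≤ B)))))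
            (ℤₚ.*-zeroʳ (w B))))))))
      where
      w : Subset t → ℤ
      w = weight ℤₚ.+-*-commutativeRing (λ _ → + 1)
      1≢0 : + 1 ≢ + 0
      1≢0 ()

  module SpanningForest (A : Subset m) (T : Fin (suc (cut A)) → V) (c : V → Fin (suc (cut A)))
    (side-c : ∀ {e} → lookup A e ≡ false → ∀ v → side e (T (c v)) ≡ side e v)
    {a ℓ} (R : CommutativeRing a ℓ) where
    open CommutativeRing R hiding (zero)
    open import Algebra.Properties.Ring ring
    open import Relation.Binary.Reasoning.Setoid setoid
    open FromℤHom R
    open Determinant R
    open CauchyBinet R
    open IntegerMatrices R
    open Forest A T c side-c
    open Incidence R

    reducedEnds : Matrix (cut A) (cut A)
    reducedEnds p i = ends p (suc i)

    φ-δ : ∀ {n} (i j : Fin n) → φ (ℤDet.δ i j) ≈ δ i j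
    φ-δ i j with does (i ≟ j)
    ... | true  = refl
    ... | false = refl

    reducedEnds-unimodular : Det reducedEnds * Det reducedEnds ≈ 1#
    reducedEnds-unimodular = trans (*-cong eq eq)
      (unimodular (λ p i → ℤI.ends p (suc i)) (λ i q → ℤI.relSide q i) ℤI.ends-relSide)
      where
      eq : Det reducedEnds ≈ Det (λ p i → φ (ℤI.ends p (suc i)))
      eq = Det-cong (λ p i → sym (trans (φ-+ (ℤDet.δ (c (x (cutEdge A p))) (suc i)) _)
        (+-cong (φ-δ (c (x (cutEdge A p))) (suc i)) (trans (φ-neg (ℤDet.δ (c (y (cutEdge A p))) (suc i)))
                                       (-‿cong (φ-δ (c (y (cutEdge A p))) (suc i)))))))

    -- Here the undetermined sign of the incidence determinant disappears.
    square : ∀ {d p} → d * Det reducedEnds ≈ p → d * d ≈ p * p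
    square {d} {p} eq = begin
      d * d                  ≈⟨ *-identityʳ _ ⟨
      (d * d) * 1#           ≈⟨ *-congˡ reducedEnds-unimodular ⟨
      (d * d) * (u * u)      ≈⟨ solve 2 (λ d u → (d :* d) :* (u :* u) := (d :* u) :* (d :* u)) refl d u ⟩
      (d * u) * (d * u)      ≈⟨ *-cong eq eq ⟩
      p * p                  ∎
      where u = Det reducedEnds

    spins : Matrix m (suc (cut A))
    spins e i = spin (side e (T i))

    -- The row `δ zero` on top of `ends` gives a square matrix with the determinant of
    -- `reducedEnds`. The bordered spins times its transpose have first row (1, 0, ..., 0), since
    -- each row of `ends` sums to zero, and the remaining block is 2I.
    bordered-minor² : let d = minor (false ∷ A) ((λ _ → 1#) ◂ spins) in
      d * d ≈ pow2 R (cut A) * pow2 R (cut A)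
    bordered-minor² = square (begin
      minor (false ∷ A) ((λ _ → 1#) ◂ spins) * Det reducedEnds
        ≈⟨ *-cong (minor≈Det (false ∷ A) ((λ _ → 1#) ◂ spins)) (sym (trans (Det-first-row N (λ j → refl)) (*-identityˡ _))) ⟩
      Det Y * Det N
        ≈⟨ *-congˡ (Det-transpose N) ⟨
      Det Y * Det (λ i j → N j i)
        ≈⟨ Det-* Y (λ i j → N j i) ⟨
      Det P
        ≈⟨ Det-first-row P (λ q → trans (∑-cong (λ i → *-comm _ _)) (trans (∑-ends q (λ _ → 1#)) (-‿inverseʳ 1#))) ⟩
      P zero zero * Det (λ p q → P (suc p) (suc q))
        ≈⟨ *-cong (trans (∑-cong (λ i → *-comm _ _)) (∑-δ zero (λ _ → 1#)))
                  (trans (Det-cong ends-spin) (Det-2δ (cut A))) ⟩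
      1# * pow2 R (cut A)
        ≈⟨ *-identityˡ _ ⟩
      pow2 R (cut A) ∎)
      where
      Y N P : Matrix (suc (cut A)) (suc (cut A))
      Y = ((λ _ → 1#) ◂ spins) ∘ cutEdge (false ∷ A)
      N = δ zero ◂ ends
      P i j = ∑ (λ e → Y i e * N j e)

    -- The degree of component zero in the contracted tree; it becomes the outdegree once the
    -- floating component has index zero.
    degree₀ : Carrier
    degree₀ = ∑ (λ p → δ (c (x (cutEdge A p))) zero + δ (c (y (cutEdge A p))) zero)

    -- Summed over all components the product would be 2I. The column of component zero is missing,
    -- so its share, a rank one matrix with trace `degree₀`, is subtracted.
    minor² : ∀ k → cut A ≡ suc k → let d = minor A (λ e i → spins e (suc i)) in
      d * d ≈ (pow2 R k * (2# - degree₀)) * (pow2 R k * (2# - degree₀))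
    minor² k cut≡ = square (begin
      minor A (λ e i → spins e (suc i)) * Det reducedEnds
        ≈⟨ *-cong (minor≈Det A _) (sym (Det-transpose reducedEnds)) ⟩
      Det X * Det (λ i j → reducedEnds j i)
        ≈⟨ Det-* X (λ i j → reducedEnds j i) ⟨
      Det (λ p q → ∑ (λ i → X p i * reducedEnds q i))
        ≈⟨ Det-cong entry ⟩
      Det (λ p q → 2# * δ p q + u p * w q)
        ≈⟨ Det-2δ+rank-one k cut≡ u w ⟩
      pow2 R k * (2# + ∑ (λ p → u p * w p))
        ≈⟨ *-congˡ (+-congˡ (trans (∑-cong (λ p → trans (sym (-‿distribʳ-* _ _)) (-‿cong (edge p)))) (∑-neg _))) ⟩
      pow2 R k * (2# - degree₀) ∎)
      where
      X : Matrix (cut A) (cut A)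
      X p i = spin (sideOf p (T (suc i)))
      u w : Row (cut A)
      u p = spin (sideOf p (T zero))
      w q = - ends q zero
      entry : ∀ p q → ∑ (λ i → X p i * reducedEnds q i) ≈ 2# * δ p q + u p * w q
      entry p q = begin
        ∑ (λ i → X p i * reducedEnds q i)
          ≈⟨ solve 3 (λ s u w → s := (u :* w :+ s) :+ u :* :- w) refl _ (u p) (ends q zero) ⟩
        (u p * ends q zero + ∑ (λ i → X p i * reducedEnds q i)) + u p * w q
          ≈⟨ +-congʳ (trans (sym (∑-suc _)) (ends-spin p q)) ⟩
        2# * δ p q + u p * w q ∎
      endpoint : ∀ {g v} p s → sideOf p v ≡ s → spin s ≈ g → u p * δ (c v) zero ≈ g * δ (c v) zero
      endpoint {g} {v} p s eq eq′ with c v ≟ zero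
      ... | yes cv≡0 = *-congʳ (trans (reflexive (≡.cong spin (≡.trans
              (≡.cong (sideOf p ∘ T) (≡.sym cv≡0)) (≡.trans (side-c (cutEdge-∉ A p) v) eq)))) eq′)
      ... | no  cv≢0 = trans (zeroʳ _) (sym (zeroʳ _))
      -- `T zero` is on the side of whichever end lies in its component, so `spin` has the sign of
      -- that end in `ends p zero`, and the orientation of the edge cancels.
      edge : ∀ p → u p * ends p zero ≈ δ (c (x (cutEdge A p))) zero + δ (c (y (cutEdge A p))) zero
      edge p = trans (x[y-z]≈xy-xz _ _ _) (trans
        (+-cong (endpoint p true (side-x (cutEdge A p)) refl) (-‿cong (endpoint p false (side-y (cutEdge A p)) refl)))
        (solve 2 (λ a b → con (+ 1) :* a :- (:- con (+ 1)) :* b := a :+ b) refl _ _))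

-- Walks, paths and connectivity.

module Connectivity {n m} (G : Graph n m) where
  open import Data.List.Membership.DecPropositional (_≟_ {n}) using () renaming (_∈?_ to _∈L?_)

  conn-refl : ∀ {P u} → ConnVia G P u u
  conn-refl = [] , _ , nil , []

  conn-step : ∀ {P e u w v} → P e → Joins G e u w → ConnVia G P w v → ConnVia G P u v
  conn-step Pe j (es , vs , p , ps) = _ , _ , step j p , Pe ∷ ps

  conn-trans : ∀ {P u v w} → ConnVia G P u v → ConnVia G P v w → ConnVia G P u w
  conn-trans (_ , _ , nil , [])           q = q
  conn-trans (_ , _ , step j p , Pe ∷ ps) q = conn-step Pe j (conn-trans (_ , _ , p , ps) q)

  conn-sym : ∀ {P u v} → ConnVia G P u v → ConnVia G P v u
  conn-sym (_ , _ , nil , [])           = conn-refl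
  conn-sym (_ , _ , step j p , Pe ∷ ps) =
    conn-trans (conn-sym (_ , _ , p , ps)) (conn-step Pe (Sum.swap j) conn-refl)

  conn-map : ∀ {P Q : Fin m → Set} {u v} → (∀ {e} → P e → Q e) → ConnVia G P u v → ConnVia G Q u v
  conn-map P⊆Q (es , vs , p , ps) = es , vs , p , All.map P⊆Q ps

  source∈ : ∀ {u v es vs} → Walk G u v es vs → u ∈L vs
  source∈ nil        = here ≡.refl
  source∈ (step j p) = here ≡.refl

  suffix : ∀ {u w v es vs} → Walk G w v es vs → Unique vs → u ∈L vs →
    ∃₂ λ es′ vs′ → Walk G u v es′ vs′ × Unique vs′
  suffix nil        uniq       (here ≡.refl) = _ , _ , nil , uniq
  suffix (step j p) uniq       (here ≡.refl) = _ , _ , step j p , uniq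
  suffix (step j p) (_ ∷ uniq) (there u∈vs)  = suffix p uniq u∈vs

  walk⇒path : ∀ {u v es vs} → Walk G u v es vs → ∃₂ λ es′ vs′ → Walk G u v es′ vs′ × Unique vs′
  walk⇒path nil = _ , _ , nil , [] ∷ []
  walk⇒path {u} (step j p) with walk⇒path p
  ... | es , vs , q , uniq with u ∈L? vs
  ...   | yes u∈vs = suffix q uniq u∈vs
  ...   | no  u∉vs = _ , _ , step j q , All.tabulate (λ z∈vs u≡z → u∉vs (≡.subst (_∈L vs) (≡.sym u≡z) z∈vs)) ∷ uniq

  endpoint∈ : ∀ {u z w v e es vs} → Walk G w v es vs → e ∈L es → Joins G e u z → u ∈L vs
  endpoint∈ (step j p) (there e∈es) k = there (endpoint∈ p e∈es k)
  endpoint∈ (step (inj₁ eq) p) (here ≡.refl) (inj₁ eq′) = here (≡.cong proj₁ (≡.trans (≡.sym eq′) eq))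
  endpoint∈ (step (inj₁ eq) p) (here ≡.refl) (inj₂ eq′)
    rewrite ≡.cong proj₂ (≡.trans (≡.sym eq′) eq) = there (source∈ p)
  endpoint∈ (step (inj₂ eq) p) (here ≡.refl) (inj₁ eq′)
    rewrite ≡.cong proj₁ (≡.trans (≡.sym eq′) eq) = there (source∈ p)
  endpoint∈ (step (inj₂ eq) p) (here ≡.refl) (inj₂ eq′) = here (≡.cong proj₂ (≡.trans (≡.sym eq′) eq))

  -- A second use of `e` would visit `u` again.
  first-edge-fresh : ∀ {u w v e es vs} → Joins G e u w → Walk G w v es vs → Unique (u ∷ vs) → e ∉L es
  first-edge-fresh j p (u∉vs ∷ _) e∈es = All.lookup u∉vs (endpoint∈ p e∈es j) ≡.refl

-- Sides of a tree edge and components of a forest.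

module TreeSides {n m} (G : Graph n m) (tree : IsTree G) where
  open Connectivity G public

  x y : Fin m → Fin n
  x e = proj₁ (G e)
  y e = proj₂ (G e)

  joins-xy : ∀ e → Joins G e (x e) (y e)
  joins-xy e = inj₁ ≡.refl

  private
    -- A walk from `v` to `x e` is followed until it first uses `e`; there it stands at an end of
    -- `e`.
    x-or-y : ∀ e v → ConnVia G (_≢ e) v (x e) ⊎ ConnVia G (_≢ e) v (y e)
    x-or-y e v with proj₁ tree v (x e)
    ... | _ , _ , p , _ = along p
      where
      along : ∀ {v es vs} → Walk G v (x e) es vs → ConnVia G (_≢ e) v (x e) ⊎ ConnVia G (_≢ e) v (y e)
      along nil = inj₁ conn-refl
      along (step {e = f} j p) with f ≟ e
      ... | no  f≢e    = Sum.map (conn-step f≢e j) (conn-step f≢e j) (along p)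
      along (step (inj₁ eq) p) | yes ≡.refl rewrite eq = inj₁ conn-refl
      along (step (inj₂ eq) p) | yes ≡.refl rewrite eq = inj₂ conn-refl

    x≁y : ∀ {e u} → ConnVia G (_≢ e) u (x e) → ¬ ConnVia G (_≢ e) u (y e)
    x≁y {e} p q = proj₂ tree e (conn-trans (conn-sym p) q)

  opaque
    -- The answer of `x-or-y` comes from a chosen walk, but the tree property admits only one.
    -- Outside this block only the three laws proved in it are used.
    side : Fin m → Fin n → Bool
    side e v with x-or-y e v
    ... | inj₁ _ = true
    ... | inj₂ _ = false

    side-conn : ∀ {e u v} → ConnVia G (_≢ e) u v → side e u ≡ side e v
    side-conn {e} {u} {v} p with x-or-y e u | x-or-y e v
    ... | inj₁ _ | inj₁ _ = ≡.refl
    ... | inj₂ _ | inj₂ _ = ≡.refl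
    ... | inj₁ q | inj₂ r = ⊥-elim (x≁y q (conn-trans p r))
    ... | inj₂ q | inj₁ r = ⊥-elim (x≁y (conn-trans p r) q)

    side-x : ∀ e → side e (x e) ≡ true
    side-x e with x-or-y e (x e)
    ... | inj₁ _ = ≡.refl
    ... | inj₂ q = ⊥-elim (x≁y conn-refl q)

    side-y : ∀ e → side e (y e) ≡ false
    side-y e with x-or-y e (y e)
    ... | inj₁ q = ⊥-elim (x≁y q conn-refl)
    ... | inj₂ _ = ≡.refl

  side-joins-≢ : ∀ {e f u v} → e ≢ f → Joins G f u v → side e u ≡ side e v
  side-joins-≢ e≢f j = side-conn (conn-step (e≢f ∘ ≡.sym) j conn-refl)

  side-xy : ∀ {e f} → e ≢ f → side e (x f) ≡ side e (y f)
  side-xy {e} {f} e≢f = side-joins-≢ e≢f (joins-xy f)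

  side-joins : ∀ {e u v} → Joins G e u v → side e u ≡ not (side e v)
  side-joins {e} (inj₁ eq) = ≡.subst (λ uv → side e (proj₁ uv) ≡ not (side e (proj₂ uv))) eq
    (≡.trans (side-x e) (≡.cong not (≡.sym (side-y e))))
  side-joins {e} (inj₂ eq) = ≡.subst (λ uv → side e (proj₂ uv) ≡ not (side e (proj₁ uv))) eq
    (≡.trans (side-y e) (≡.cong not (≡.sym (side-x e))))

  side-walk : ∀ {e u v es vs} → Walk G u v es vs → e ∉L es → side e u ≡ side e v
  side-walk p e∉es = side-conn (_ , _ , p , All.tabulate (λ f∈es f≡e → e∉es (≡.subst (_∈L _) f≡e f∈es)))

  path : ∀ u v → ∃₂ λ es vs → Walk G u v es vs × Unique vs
  path u v = walk⇒path (proj₁ (proj₂ (proj₂ (proj₁ tree u v))))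

  -- A path uses `e` at most once, so the side flips exactly once.
  side-path : ∀ {e u v es vs} → Walk G u v es vs → Unique vs → e ∈L es → side e u ≡ not (side e v)
  side-path (step j p) uniq (here ≡.refl) =
    ≡.trans (side-joins j) (≡.cong not (side-walk p (first-edge-fresh j p uniq)))
  side-path (step j p) uniq@(_ ∷ uniq′) (there e∈es) =
    ≡.trans (side-joins-≢ (λ { ≡.refl → first-edge-fresh j p uniq e∈es }) j) (side-path p uniq′ e∈es)

  -- A decidable form of connectivity in the forest `A`: it inspects the finitely many deleted edges
  -- in place of all walks.
  Same : Subset m → Fin n → Fin n → Set
  Same A u v = ∀ e → lookup A e ≡ false → side e u ≡ side e v

  same? : ∀ A u v → Dec (Same A u v)
  same? A u v = Finₚ.all? (λ e → (lookup A e Boolₚ.≟ false) →-dec (side e u Boolₚ.≟ side e v))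

  same-sym : ∀ A {u v} → Same A u v → Same A v u
  same-sym A s e e∉A = ≡.sym (s e e∉A)

  same-trans : ∀ A {u v w} → Same A u v → Same A v w → Same A u w
  same-trans A s t e e∉A = ≡.trans (s e e∉A) (t e e∉A)

  true≢false : true ≢ false
  true≢false ()

  conn⇒same : ∀ {A u v} → Conn G A u v → Same A u v
  conn⇒same p e e∉A = side-conn (conn-map
    (λ f∈A f≡e → true≢false (≡.trans (≡.sym ([]=⇒lookup (≡.subst (_∈ _) f≡e f∈A))) e∉A)) p)

  -- The path in the tree stays in `A`, since a deleted edge on it would separate its ends.
  same⇒conn : ∀ {A u v} → Same A u v → Conn G A u v
  same⇒conn {A} {u} {v} s with path u v
  ... | es , vs , p , uniq = es , vs , p , All.tabulate kept
    where
    kept : ∀ {e} → e ∈L es → e ∈ A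
    kept {e} e∈es with lookup A e in eq
    ... | true  = lookup⇒[]= e A eq
    ... | false = ⊥-elim (Boolₚ.not-¬ (s e eq) (side-path p uniq e∈es))

  same-xy : ∀ {A e} → lookup A e ≡ true → Same A (x e) (y e)
  same-xy {A} {e} e∈A = conn⇒same (conn-step (lookup⇒[]= e A e∈A) (joins-xy e) conn-refl)

  acyclic : ∀ A → Acyclic G A
  acyclic A e e∈A p = proj₂ tree e (conn-map proj₂ p)

  Distinct : ∀ {t} → Subset m → (Fin t → Fin n) → Set
  Distinct A T = ∀ i j → Same A (T i) (T j) → i ≡ j

  Rooted : ∀ {t} → Subset m → (Fin t → Fin n) → Set
  Rooted A T = ∀ v → ∃ λ i → Same A v (T i)

  -- Outside the component of r, the path to r leaves the component through
  -- some cut edge, at the endpoint of that edge separated from r.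
  module _ (A : Subset m) (r : Fin n) where

    far : Fin m → Fin n
    far e = if side e r then y e else x e

    far-unique : ∀ {e u v} → Joins G e u v → side e u ≡ not (side e r) → u ≡ far e
    far-unique {e} (inj₁ eq) s rewrite ≡.sym (≡.cong proj₁ eq) | side-x e with side e r
    ... | false = ≡.refl
    far-unique {e} (inj₂ eq) s rewrite ≡.sym (≡.cong proj₂ eq) | side-y e with side e r
    ... | true  = ≡.refl

    anchor : Fin (suc (cut A)) → Fin n
    anchor = r ◂ (far ∘ cutEdge A)

    label : ∀ v → ∃ λ l → Same A v (anchor l)
    label v with path v r
    ... | _ , _ , p , uniq = along p uniq
      where
      along : ∀ {v es vs} → Walk G v r es vs → Unique vs → ∃ λ l → Same A v (anchor l)
      along nil uniq = zero , λ e _ → ≡.refl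
      along (step {e = f} j p) uniq@(_ ∷ uniq′) with lookup A f in f∈A
      ... | true  with along p uniq′
      ...   | l , s = l , same-trans A
                (conn⇒same (conn-step (lookup⇒[]= f A f∈A) j conn-refl)) s
      along (step {e = f} j p) uniq | false with cutEdge-surjective A f f∈A
      ... | q , ≡.refl = suc q , λ e _ → ≡.cong (side e)
              (far-unique j (side-path (step j p) uniq (here ≡.refl)))

  -- Vertices with the same `label` share an anchor and hence a component, so `label` is injective
  -- on `T`.
  distinct⇒≤ : ∀ {t} A (T : Fin t → Fin n) → Distinct A T → t ℕ.≤ suc (cut A)
  distinct⇒≤ {zero}  A T distinct = z≤n
  distinct⇒≤ {suc t} A T distinct = Finₚ.injective⇒≤ {f = proj₁ ∘ label A r ∘ T} (λ {i} {j} eq →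
    distinct i j (same-trans A (proj₂ (label A r (T i)))
      (≡.subst (λ l → Same A (anchor A r l) (T j)) (≡.sym eq) (same-sym A (proj₂ (label A r (T j)))))))
    where r = T zero

  open Sides x y side side-x side-y side-xy public

  -- The contracted tree has one vertex more than edges. One inequality is the rank argument
  -- `cut≤t`, the other counts components by anchors.
  distinct-rooted⇒cut : ∀ {t} A (T : Fin (suc t) → Fin n) → Distinct A T → Rooted A T → cut A ≡ t
  distinct-rooted⇒cut A T distinct rooted = ℕₚ.≤-antisym
    (Forest.cut≤t A T (proj₁ ∘ rooted) (λ {e} e∉A v → ≡.sym (proj₂ (rooted v) e e∉A)))
    (ℕₚ.≤-pred (distinct⇒≤ A T distinct))

  ◂-distinct : ∀ {t} A {T : Fin t → Fin n} {v} → Distinct A T → (∀ i → ¬ Same A v (T i)) → Distinct A (v ◂ T)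
  ◂-distinct A distinct v≁T zero    zero    s = ≡.refl
  ◂-distinct A distinct v≁T zero    (suc j) s = ⊥-elim (v≁T j s)
  ◂-distinct A distinct v≁T (suc i) zero    s = ⊥-elim (v≁T i (same-sym A s))
  ◂-distinct A distinct v≁T (suc i) (suc j) s = ≡.cong suc (distinct i j s)

  -- A vertex outside the components of `T` would extend `T` beyond the bound `distinct⇒≤`.
  distinct-cut⇒rooted : ∀ {t} A (T : Fin t → Fin n) → Distinct A T → t ≡ suc (cut A) → Rooted A T
  distinct-cut⇒rooted A T distinct t≡ v with Finₚ.any? (λ i → same? A v (T i))
  ... | yes found = found
  ... | no  none  = ⊥-elim (ℕₚ.<⇒≱ (s≤s (ℕₚ.≤-reflexive (≡.sym t≡)))
          (distinct⇒≤ A (v ◂ T) (◂-distinct A distinct (λ i s → none (i , s)))))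

  repeated-or-distinct : ∀ {t} A (T : Fin t → Fin n) →
    (∃₂ λ i j → i ≢ j × Same A (T i) (T j)) ⊎ Distinct A T
  repeated-or-distinct A T
    with Finₚ.any? (λ i → Finₚ.any? (λ j → ¬? (i ≟ j) ×-dec same? A (T i) (T j)))
  ... | yes (i , j , i≢j , s) = inj₁ (i , j , i≢j , s)
  ... | no  none = inj₂ distinct
    where
    distinct : Distinct A T
    distinct i j s with i ≟ j
    ... | yes i≡j = i≡j
    ... | no  i≢j = ⊥-elim (none (i , j , i≢j , s))

-- Rooted forests expressed by sides.

module Classification {n m} (G : Graph n m) (tree : IsTree G) where
  open TreeSides G tree public

  F1⇒distinct : ∀ {t A} {S : Fin t → Fin n} → IsF1 G S A → Distinct A S
  F1⇒distinct {S = S} (_ , f1) i j s = proj₂ (f1 (S i)) i j conn-refl (same⇒conn s)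

  F1⇒rooted : ∀ {t A} {S : Fin t → Fin n} → IsF1 G S A → Rooted A S
  F1⇒rooted (_ , f1) v = proj₁ (proj₁ (f1 v)) , conn⇒same (proj₂ (proj₁ (f1 v)))

  distinct-rooted⇒F1 : ∀ {t A} {S : Fin t → Fin n} → Distinct A S → Rooted A S → IsF1 G S A
  distinct-rooted⇒F1 {A = A} distinct rooted = acyclic A , λ v →
    (proj₁ (rooted v) , same⇒conn (proj₂ (rooted v))) ,
    λ i j p q → distinct i j (same-trans A (same-sym A (conn⇒same p)) (conn⇒same q))

  floating? : ∀ {t} A (S : Fin t → Fin n) v → Floating G S A v ⊎ ∃ λ i → Same A v (S i)
  floating? A S v with Finₚ.any? (λ i → same? A v (S i))
  ... | yes found = inj₂ found
  ... | no  none  = inj₁ (λ (i , p) → none (i , conn⇒same p))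

  module _ {t A} {S : Fin t → Fin n} {f} (distinct : Distinct A (f ◂ S)) (rooted : Rooted A (f ◂ S)) where

    -- The floating representative `f` has index zero, which is the column that `minor²` omits.
    rootIsFloating : Fin n → Bool
    rootIsFloating v = does (proj₁ (rooted v) ≟ zero)

    floating⇒root : ∀ {v} → Floating G S A v → proj₁ (rooted v) ≡ zero
    floating⇒root {v} fl with rooted v
    ... | zero  , s = ≡.refl
    ... | suc i , s = ⊥-elim (fl (i , same⇒conn s))

    root⇒floating : ∀ {v} → proj₁ (rooted v) ≡ zero → Floating G S A v
    root⇒floating {v} eq (i , p) with rooted v
    root⇒floating {v} ≡.refl (i , p) | zero , s
      with () ← distinct zero (suc i) (same-trans A (same-sym A s) (conn⇒same p))

    distinct-rooted⇒F2 : IsF2 G S A (tabulate rootIsFloating)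
    distinct-rooted⇒F2 = acyclic A ,
      (λ i j p → Finₚ.suc-injective (distinct (suc i) (suc j) (conn⇒same p))) ,
      (f , root⇒floating (distinct _ _ (same-sym A (proj₂ (rooted f))))) ,
      (λ u v flu flv → same⇒conn (same-trans A (toRoot flu) (same-sym A (toRoot flv)))) ,
      λ v → (λ v∈Fl → root⇒floating (root v v∈Fl)) ,
            (λ fl → lookup⇒[]= v _ (≡.trans (lookup∘tabulate _ v) (dec-true (_ ≟ zero) (floating⇒root fl))))
      where
      toRoot : ∀ {v} → Floating G S A v → Same A v f
      toRoot {v} fl = ≡.subst (λ i → Same A v ((f ◂ S) i)) (floating⇒root fl) (proj₂ (rooted v))
      root : ∀ v → v ∈ tabulate rootIsFloating → proj₁ (rooted v) ≡ zero
      root v v∈Fl with proj₁ (rooted v) ≟ zero | ≡.trans (≡.sym (lookup∘tabulate rootIsFloating v)) ([]=⇒lookup v∈Fl)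
      ... | yes eq | _ = eq

    F2⇒root : ∀ {Fl} → IsF2 G S A Fl → ∀ v → lookup Fl v ≡ rootIsFloating v
    F2⇒root {Fl} (_ , _ , _ , _ , spec) v with proj₁ (rooted v) ≟ zero
    ... | yes eq = []=⇒lookup (proj₂ (spec v) (root⇒floating eq))
    ... | no neq with lookup Fl v in eq
    ...   | true  = ⊥-elim (neq (floating⇒root (proj₁ (spec v) (lookup⇒[]= v Fl eq))))
    ...   | false = ≡.refl

  F2⇒distinct-rooted : ∀ {t A Fl} {S : Fin t → Fin n} → IsF2 G S A Fl →
    ∃ λ f → Distinct A (f ◂ S) × Rooted A (f ◂ S)
  F2⇒distinct-rooted {A = A} {S = S} (_ , inj , (f , flf) , one , _) =
    f , ◂-distinct A (λ i j s → inj i j (same⇒conn s)) (λ i s → flf (i , same⇒conn s)) , rooted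
    where
    rooted : Rooted A (f ◂ S)
    rooted v with floating? A S v
    ... | inj₁ fl      = zero , conn⇒same (one v f fl flf)
    ... | inj₂ (i , s) = suc i , s

  -- Allows a list of pairs `(A , Fl)` to be summed as a list of edge sets `A` without repetition.
  F2-unique : ∀ {t A Fl Fl′} {S : Fin t → Fin n} → IsF2 G S A Fl → IsF2 G S A Fl′ → Fl ≡ Fl′
  F2-unique {Fl = Fl} {Fl′} f2 f2′ with F2⇒distinct-rooted f2
  ... | f , distinct , rooted = ≡.trans (≡.sym (tabulate∘lookup Fl)) (≡.trans
    (tabulate-cong (λ v → ≡.trans (F2⇒root distinct rooted f2 v) (≡.sym (F2⇒root distinct rooted f2′ v))))
    (tabulate∘lookup Fl′))

-- Values of the squared minors.

module PrincipalMinor {a ℓ} (R : CommutativeRing a ℓ)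
  {n m} (G : Graph n m) (tree : IsTree G) where
  open CommutativeRing R hiding (zero)
  open import Relation.Binary.Reasoning.Setoid setoid
  open Determinant R
  open CauchyBinet R
  open Classification G tree

  spins : ∀ {t} → (Fin t → Fin n) → Matrix m t
  spins S e i = spin (side e (S i))

  bordered : ∀ {t} → (Fin t → Fin n) → Matrix (suc m) t
  bordered S = (λ _ → 1#) ◂ spins S

  F1-minor² : ∀ {k A} (S : Fin (suc k) → Fin n) → IsF1 G S A →
    cut A ≡ k × minor (false ∷ A) (bordered S) * minor (false ∷ A) (bordered S) ≈ pow2 R k * pow2 R k
  F1-minor² {k} {A} S f1 with distinct-rooted⇒cut A S (F1⇒distinct f1) (F1⇒rooted f1)
  ... | ≡.refl = ≡.refl , (SpanningForest.bordered-minor² A S _ (λ {e} e∉A v → ≡.sym (proj₂ (F1⇒rooted f1 v) e e∉A)) R)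

  -- Two vertices of `S` in one component have equal columns. Otherwise a minor of the right size
  -- would have `cut A ≡ k`, and then `S` meets every component.
  ¬F1-minor : ∀ {k A} (S : Fin (suc k) → Fin n) → ¬ IsF1 G S A → minor (false ∷ A) (bordered S) ≈ 0#
  ¬F1-minor {k} {A} S ¬f1 with repeated-or-distinct A S
  ... | inj₁ (i , j , i≢j , s) = minor-equal-columns (false ∷ A) (bordered S) i j i≢j
          λ { zero _ → refl ; (suc e) e∉A → reflexive (≡.cong spin (s e e∉A)) }
  ... | inj₂ distinct = minor≈0 (false ∷ A) (bordered S) λ cut≡k →
          ¬f1 (distinct-rooted⇒F1 distinct (distinct-cut⇒rooted A S distinct (≡.sym cut≡k)))

  -- With distinct components and a minor of the right size, `S` misses exactly one component: a
  -- missed vertex completes `S` to a full set of representatives, and if none were missed there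
  -- would be one deleted edge fewer.
  ¬F2-minor : ∀ {k A} (S : Fin (suc k) → Fin n) → (∀ Fl → ¬ IsF2 G S A Fl) → minor A (spins S) ≈ 0#
  ¬F2-minor {k} {A} S ¬f2 with repeated-or-distinct A S
  ... | inj₁ (i , j , i≢j , s) = minor-equal-columns A (spins S) i j i≢j
          λ e e∉A → reflexive (≡.cong spin (s e e∉A))
  ... | inj₂ distinct = minor≈0 A (spins S) impossible
    where
    impossible : cut A ≢ suc k
    impossible cut≡k with Finₚ.any? (λ v → ¬? (Finₚ.any? (λ i → same? A v (S i))))
    ... | yes (f , none) = ¬f2 _ (distinct-rooted⇒F2 distinct′
            (distinct-cut⇒rooted A (f ◂ S) distinct′ (≡.cong suc (≡.sym cut≡k))))
      where distinct′ = ◂-distinct A distinct (λ i s → none (i , s))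
    ... | no all = ℕₚ.1+n≢n (≡.trans (≡.sym cut≡k) (distinct-rooted⇒cut A S distinct rooted))
      where
      rooted : Rooted A S
      rooted v with Finₚ.any? (λ i → same? A v (S i))
      ... | yes found = found
      ... | no  none  = ⊥-elim (all (v , none))

  natR-outdeg : ∀ {m} (H : Graph n m) Fl →
    natR R (outdeg H Fl) ≈ ∑ (λ e → ⟦ lookup Fl (proj₁ (H e)) xor lookup Fl (proj₂ (H e)) ⟧)
  natR-outdeg {zero}  H Fl = sym (∑-empty _)
  natR-outdeg {suc m} H Fl = trans (head (lookup Fl (proj₁ (H zero)) xor lookup Fl (proj₂ (H zero))))
    (sym (∑-suc _))
    where
    head : ∀ b → natR R ((if b then 1 else 0) ℕ.+ outdeg (H ∘ suc) Fl) ≈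
                 ⟦ b ⟧ + ∑ (λ e → ⟦ lookup Fl (proj₁ (H (suc e))) xor lookup Fl (proj₂ (H (suc e))) ⟧)
    head true  = +-congˡ (natR-outdeg (H ∘ suc) Fl)
    head false = trans (natR-outdeg (H ∘ suc) Fl) (sym (+-identityˡ _))

  ∑-cutEdge : ∀ {m} (A : Subset m) (f : Row m) → (∀ e → lookup A e ≡ true → f e ≈ 0#) →
    ∑ f ≈ ∑ (f ∘ cutEdge A)
  ∑-cutEdge []          f f≈0 = trans (∑-empty _) (sym (∑-empty _))
  ∑-cutEdge (true  ∷ A) f f≈0 = trans (∑-suc f) (trans
    (+-cong (f≈0 zero ≡.refl) (∑-cutEdge A (f ∘ suc) (f≈0 ∘ suc))) (+-identityˡ _))
  ∑-cutEdge (false ∷ A) f f≈0 = trans (∑-suc f) (trans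
    (+-congˡ (∑-cutEdge A (f ∘ suc) (f≈0 ∘ suc))) (sym (∑-suc _)))

  -- The number of roots is a variable `t`, so that `cut A ≡ t` can be matched with `refl`; `suc k`
  -- would not unify with `cut A`.
  F2-minor² : ∀ {t k A Fl} (S : Fin t → Fin n) → t ≡ suc k → IsF2 G S A Fl →
    let p = pow2 R k * (2# - natR R (outdeg G Fl)) in
    cut A ≡ t × minor A (spins S) * minor A (spins S) ≈ p * p
  F2-minor² {t} {k} {A} {Fl} S t≡ f2 with F2⇒distinct-rooted f2
  ... | f , distinct , rooted with distinct-rooted⇒cut A (f ◂ S) distinct rooted
  ...   | ≡.refl = ≡.refl , trans (SF.minor² k t≡) (*-cong eq eq)
    where
    c : Fin n → Fin (suc (cut A))
    c = proj₁ ∘ rooted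
    module SF = SpanningForest A (f ◂ S) c (λ {e} e∉A v → ≡.sym (proj₂ (rooted v) e e∉A)) R
    zero? : Fin n → Bool
    zero? v = does (c v ≟ zero)
    kept : ∀ e → lookup A e ≡ true → ⟦ zero? (x e) xor zero? (y e) ⟧ ≈ 0#
    kept e e∈A = reflexive (≡.cong ⟦_⟧ (≡.trans
      (≡.cong (λ i → does (i ≟ zero) xor zero? (y e)) (distinct (c (x e)) (c (y e))
        (same-trans A (same-sym A (proj₂ (rooted (x e)))) (same-trans A (same-xy {A} e∈A) (proj₂ (rooted (y e)))))))
      (Boolₚ.xor-same (zero? (y e)))))
    -- The ends of a deleted edge lie in different components and are never both floating, so `xor`
    -- agrees with the sum.
    removed : ∀ e → lookup A e ≡ false →
      ⟦ zero? (x e) xor zero? (y e) ⟧ ≈ δ (c (x e)) zero + δ (c (y e)) zero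
    removed e e∉A with c (x e) ≟ zero | c (y e) ≟ zero
    ... | no  _   | no _    = sym (+-identityˡ _)
    ... | no  _   | yes _   = sym (+-identityˡ _)
    ... | yes _   | no _    = sym (+-identityʳ _)
    ... | yes cx≡0 | yes cy≡0 = ⊥-elim (true≢false (≡.trans (≡.sym (side-x e)) (≡.trans
          (proj₂ (rooted (x e)) e e∉A) (≡.trans (≡.cong (side e ∘ (f ◂ S)) (≡.trans cx≡0 (≡.sym cy≡0)))
          (≡.trans (≡.sym (proj₂ (rooted (y e)) e e∉A)) (side-y e))))))
    degree : SF.degree₀ ≈ natR R (outdeg G Fl)
    degree = sym (begin
      natR R (outdeg G Fl)
        ≈⟨ natR-outdeg G Fl ⟩
      ∑ (λ e → ⟦ lookup Fl (x e) xor lookup Fl (y e) ⟧)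
        ≈⟨ ∑-cong (λ e → reflexive (≡.cong₂ (λ b b′ → ⟦ b xor b′ ⟧)
             (F2⇒root distinct rooted f2 (x e)) (F2⇒root distinct rooted f2 (y e)))) ⟩
      ∑ (λ e → ⟦ zero? (x e) xor zero? (y e) ⟧)
        ≈⟨ ∑-cutEdge A _ kept ⟩
      ∑ (λ p → ⟦ zero? (x (cutEdge A p)) xor zero? (y (cutEdge A p)) ⟧)
        ≈⟨ ∑-cong (λ p → removed (cutEdge A p) (cutEdge-∉ A p)) ⟩
      SF.degree₀ ∎)
    eq : pow2 R k * (2# - SF.degree₀) ≈ pow2 R k * (2# - natR R (outdeg G Fl))
    eq = *-congˡ (+-congˡ (-‿cong degree))

-- From sums over all subsets to sums over lists.

unique⇒keys-differ : ∀ {X K : Set} (key : X → K) (L : List X) →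
  (∀ {p q} → p ∈L L → q ∈L L → key p ≡ key q → p ≡ q) → Unique L →
  AllPairs (λ p q → key p ≢ key q) L
unique⇒keys-differ key []      inj []           = []
unique⇒keys-differ key (p ∷ L) inj (p∉L ∷ uniq) =
  All.tabulate (λ q∈L eq → All.lookup p∉L q∈L (inj (here ≡.refl) (there q∈L) eq)) ∷
  unique⇒keys-differ key L (λ p∈L q∈L → inj (there p∈L) (there q∈L)) uniq

module SubsetLists {a ℓ} (R : CommutativeRing a ℓ) where
  open CommutativeRing R hiding (zero)
  open CauchyBinet R

  -- Each list entry splits off the value of `f` at its key. As the keys differ, setting that value
  -- to zero does not disturb the remaining entries.
  ∑ˢ-list : ∀ {m} {X : Set} (key : X → Subset m) (L : List X) (f : Subset m → Carrier) (g : X → Carrier) →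
    AllPairs (λ p q → key p ≢ key q) L → (∀ {p} → p ∈L L → f (key p) ≈ g p) →
    (∀ A → (∀ {p} → p ∈L L → A ≢ key p) → f A ≈ 0#) → ∑ˢ f ≈ sumList R g L
  ∑ˢ-list key []      f g differ f≈g f≈0 = ∑ˢ-zero (λ A → f≈0 A (λ ()))
  ∑ˢ-list {m} key (p ∷ L) f g (p∉L ∷ differ) f≈g f≈0 = trans (∑ˢ-cong split) (trans (∑ˢ-+ at elsewhere) (+-cong
    (trans (∑ˢ-single at (key p) (λ A A≢ → at-≢ A≢)) (trans (at-≡ ≡.refl) (f≈g (here ≡.refl))))
    (∑ˢ-list key L elsewhere g differ
      (λ q∈L → trans (elsewhere-≢ (λ eq → All.lookup p∉L q∈L (≡.sym eq))) (f≈g (there q∈L)))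
      off)))
    where
    _≟ˢ_ : (A B : Subset m) → Dec (A ≡ B)
    _≟ˢ_ = ≡-dec Boolₚ._≟_
    at elsewhere : Subset m → Carrier
    at        A = if does (A ≟ˢ key p) then f A else 0#
    elsewhere A = if does (A ≟ˢ key p) then 0# else f A
    split : ∀ A → f A ≈ at A + elsewhere A
    split A with does (A ≟ˢ key p)
    ... | true  = sym (+-identityʳ _)
    ... | false = sym (+-identityˡ _)
    at-≢ : ∀ {A} → A ≢ key p → at A ≈ 0#
    at-≢ {A} A≢ with A ≟ˢ key p
    ... | yes eq = ⊥-elim (A≢ eq)
    ... | no  _  = refl
    at-≡ : ∀ {A} → A ≡ key p → at A ≈ f A
    at-≡ {A} eq with A ≟ˢ key p
    ... | yes _  = refl
    ... | no  A≢ = ⊥-elim (A≢ eq)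
    elsewhere-≢ : ∀ {A} → A ≢ key p → elsewhere A ≈ f A
    elsewhere-≢ {A} A≢ with A ≟ˢ key p
    ... | yes eq = ⊥-elim (A≢ eq)
    ... | no  _  = refl
    off : ∀ A → (∀ {q} → q ∈L L → A ≢ key q) → elsewhere A ≈ 0#
    off A A∉L with A ≟ˢ key p
    ... | yes _  = refl
    ... | no  A≢ = f≈0 A λ { (here ≡.refl) → A≢ ; (there q∈L) → A∉L q∈L }

  sumList-*ˡ : ∀ {X : Set} x (g : X → Carrier) L → sumList R (λ p → x * g p) L ≈ x * sumList R g L
  sumList-*ˡ x g []      = sym (zeroʳ x)
  sumList-*ˡ x g (p ∷ L) = trans (+-congˡ (sumList-*ˡ x g L)) (sym (distribˡ x _ _))

-- The distance matrix, its decomposition and the determinant.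

module DistanceMatrix {a ℓ} (R : CommutativeRing a ℓ) {n m} (G : Graph n m) (tree : IsTree G)
  (α : Fin m → CommutativeRing.Carrier R) where
  open CommutativeRing R hiding (zero)
  open import Algebra.Properties.Semiring.Exp semiring using (_^_)
  open import Relation.Binary.Reasoning.Setoid setoid
  open FromℤHom R
  open Determinant R
  open CauchyBinet R
  open Classification G tree
  open PrincipalMinor R G tree
  open SubsetLists R

  separated : Fin n → Fin n → Fin m → Bool
  separated u v e = side e u xor side e v

  -- The rest of the path avoids its first edge `f`, so `f` separates `u` from `v` but not `w` from
  -- `v`. Every other edge has `u` and `w` on the same side.
  path-length : ∀ {u v es vs} → Walk G u v es vs → Unique vs →
    sumList R α es ≈ ∑ (λ e → ⟦ separated u v e ⟧ * α e)
  path-length {u} nil uniq = sym (∑-zero (λ e →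
    trans (*-congʳ (reflexive (≡.cong ⟦_⟧ (Boolₚ.xor-same (side e u))))) (zeroˡ _)))
  path-length {u} {v} (step {w = w} {e = f} {es = es} j p) uniq@(_ ∷ uniq′) = sym (begin
    ∑ (λ e → ⟦ separated u v e ⟧ * α e)
      ≈⟨ ∑-cong (λ e → trans (*-congʳ (crossing e)) (distribʳ _ _ _)) ⟩
    ∑ (λ e → δ f e * α e + ⟦ separated w v e ⟧ * α e)
      ≈⟨ ∑-+ _ _ ⟩
    ∑ (λ e → δ f e * α e) + ∑ (λ e → ⟦ separated w v e ⟧ * α e)
      ≈⟨ +-cong (∑-δ f α) (sym (path-length p uniq′)) ⟩
    α f + sumList R α es ∎)
    where
    crossing : ∀ e → ⟦ separated u v e ⟧ ≈ δ f e + ⟦ separated w v e ⟧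
    crossing e with f ≟ e
    ... | no f≢e = trans (reflexive (≡.cong (λ s → ⟦ s xor side e v ⟧) (side-joins-≢ (f≢e ∘ ≡.sym) j)))
                         (sym (+-identityˡ _))
    ... | yes ≡.refl = trans (reflexive (≡.cong ⟦_⟧ (≡.cong₂ _xor_ (side-joins j) (≡.refl {x = side f v}))))
          (trans (reflexive (≡.cong (λ s → ⟦ not s xor side f v ⟧) w~v))
          (trans (flip (side f v)) (reflexive (≡.cong (λ s → 1# + ⟦ s xor side f v ⟧) (≡.sym w~v)))))
      where
      w~v : side f w ≡ side f v
      w~v = side-walk p (first-edge-fresh j p uniq)
      flip : ∀ b → ⟦ not b xor b ⟧ ≈ 1# + ⟦ b xor b ⟧
      flip true  = sym (+-identityʳ _)
      flip false = sym (+-identityʳ _)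

  module _ (half : Carrier) (2half : 2# * half ≈ 1#)
    (D : Fin n → Fin n → Carrier) (isD : IsDistanceMatrix R G α D) where

    total : Carrier
    total = ∑ α

    -- The factor 1/2 goes into the weights, so that the decomposition of the distance matrix is
    -- literally a product in the form of `cauchy-binet`, with the row of ones as index zero.
    coefficients : Row (suc m)
    coefficients = (half * total) ◂ (λ e → - half * α e)

    separated-spin : ∀ b b′ → ⟦ b xor b′ ⟧ ≈ half * (1# - spin b * spin b′)
    separated-spin true  true  = solve 1 (λ h → con (+ 0) := h :* (con (+ 1) :- con (+ 1) :* con (+ 1))) refl half
    separated-spin false false = solve 1 (λ h → con (+ 0) := h :* (con (+ 1) :- :- con (+ 1) :* :- con (+ 1))) refl half
    separated-spin true  false = trans (sym 2half)
      (solve 1 (λ h → con (+ 2) :* h := h :* (con (+ 1) :- con (+ 1) :* :- con (+ 1))) refl half)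
    separated-spin false true  = trans (sym 2half)
      (solve 1 (λ h → con (+ 2) :* h := h :* (con (+ 1) :- :- con (+ 1) :* con (+ 1))) refl half)

    distance : ∀ {t} (S : Fin t → Fin n) i j →
      D (S i) (S j) ≈ ∑ (λ e → coefficients e * (bordered S e i * bordered S e j))
    distance S i j with path (S i) (S j)
    ... | es , vs , p , uniq = begin
      D (S i) (S j)
        ≈⟨ isD _ _ es vs p uniq ⟩
      sumList R α es
        ≈⟨ path-length p uniq ⟩
      ∑ (λ e → ⟦ separated (S i) (S j) e ⟧ * α e)
        ≈⟨ ∑-cong (λ e → trans (*-congʳ (separated-spin (side e (S i)) (side e (S j))))
             (solve 3 (λ h q a → (h :* (con (+ 1) :- q)) :* a := h :* a :+ (:- h :* a) :* q)
                refl half (spins S e i * spins S e j) (α e))) ⟩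
      ∑ (λ e → half * α e + (- half * α e) * (spins S e i * spins S e j))
        ≈⟨ ∑-+ _ _ ⟩
      ∑ (λ e → half * α e) + ∑ (λ e → (- half * α e) * (spins S e i * spins S e j))
        ≈⟨ +-congʳ (trans (∑-*ˡ half α) (sym (trans (*-congˡ (*-identityˡ 1#)) (*-identityʳ _)))) ⟩
      (half * total) * (1# * 1#) + ∑ (λ e → (- half * α e) * (spins S e i * spins S e j))
        ≈⟨ ∑-suc _ ⟨
      ∑ (λ e → coefficients e * (bordered S e i * bordered S e j)) ∎

    weight-scale : ∀ {m} z (β : Fin m → Carrier) A →
      weight R (λ e → z * β e) A ≈ (z ^ cut A) * weight R β A
    weight-scale z β []          = sym (*-identityˡ _)
    weight-scale z β (true  ∷ A) = trans (*-identityˡ _)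
      (trans (weight-scale z (β ∘ suc) A) (*-congˡ (sym (*-identityˡ _))))
    weight-scale z β (false ∷ A) = trans (*-congˡ (weight-scale z (β ∘ suc) A))
      (solve 4 (λ z b p w → (z :* b) :* (p :* w) := (z :* p) :* (b :* w)) refl _ _ _ _)

    -- Deleted edges bring a factor `- half` each, and the squared minor brings the fourth powers
    -- `4^k`-wise, as the square of `pow2 R k`.
    half-power : ∀ k → ((- half) ^ k) * (pow2 R k * pow2 R k) ≈ sgn R k * pow2 R k
    half-power zero    = *-congˡ (*-identityˡ _)
    half-power (suc k) = begin
      (- half * ((- half) ^ k)) * ((2# * pow2 R k) * (2# * pow2 R k))
        ≈⟨ solve 3 (λ h z p → (:- h :* z) :* ((con (+ 2) :* p) :* (con (+ 2) :* p)) :=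
                     ((con (+ 2) :* h) :* (:- con (+ 2))) :* (z :* (p :* p))) refl half ((- half) ^ k) (pow2 R k) ⟩
      ((2# * half) * - 2#) * (((- half) ^ k) * (pow2 R k * pow2 R k))
        ≈⟨ *-cong (*-congʳ 2half) (half-power k) ⟩
      (1# * - 2#) * (sgn R k * pow2 R k)
        ≈⟨ solve 2 (λ s p → (con (+ 1) :* (:- con (+ 2))) :* (s :* p) := (:- s) :* (con (+ 2) :* p)) refl _ _ ⟩
      - sgn R k * (2# * pow2 R k) ∎

    pow2m1≈ : ∀ k → pow2m1 R half k ≈ half * pow2 R k
    pow2m1≈ zero    = sym (*-identityʳ _)
    pow2m1≈ (suc k) = sym (trans (solve 2 (λ h p → h :* (con (+ 2) :* p) := (con (+ 2) :* h) :* p) refl half _)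
      (trans (*-congʳ 2half) (*-identityˡ _)))

    module _ {k} (S : Fin (suc k) → Fin n) where

      scale : Carrier
      scale = sgn R k * pow2m1 R half k

      summand : Subset (suc m) → Carrier
      summand A = weight R coefficients A * (minor A (bordered S) * minor A (bordered S))

      F1-summand : ∀ A → IsF1 G S A → summand (false ∷ A) ≈ (scale * total) * weight R α A
      F1-summand A f1 with F1-minor² S f1
      ... | ≡.refl , square = begin
        ((half * total) * weight R (λ e → - half * α e) A) * (minor (false ∷ A) (bordered S) * minor (false ∷ A) (bordered S))
          ≈⟨ *-cong (*-congˡ (weight-scale (- half) α A)) square ⟩
        ((half * total) * (((- half) ^ k) * weight R α A)) * (pow2 R k * pow2 R k)
          ≈⟨ solve 5 (λ h t z w p → ((h :* t) :* (z :* w)) :* (p :* p) := (h :* (z :* (p :* p))) :* (t :* w))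
               refl half total ((- half) ^ k) (weight R α A) (pow2 R k) ⟩
        (half * (((- half) ^ k) * (pow2 R k * pow2 R k))) * (total * weight R α A)
          ≈⟨ *-congʳ (*-congˡ (half-power k)) ⟩
        (half * (sgn R k * pow2 R k)) * (total * weight R α A)
          ≈⟨ solve 5 (λ h s p t w → (h :* (s :* p)) :* (t :* w) := ((s :* (h :* p)) :* t) :* w)
               refl half (sgn R k) (pow2 R k) total (weight R α A) ⟩
        ((sgn R k * (half * pow2 R k)) * total) * weight R α A
          ≈⟨ *-congʳ (*-congʳ (*-congˡ (pow2m1≈ k))) ⟨
        (scale * total) * weight R α A ∎

      -- Here `suc k` edges are deleted. The additional factor `- half` stands where an `F1` term
      -- has `half * total`: it gives the same `scale` and accounts for the minus sign.
      F2-summand : ∀ A Fl → IsF2 G S A Fl → let o = natR R (outdeg G Fl) - 2# in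
        summand (true ∷ A) ≈ - scale * (weight R α A * (o * o))
      F2-summand A Fl f2 with F2-minor² S ≡.refl f2
      ... | cut≡ , square = begin
        (1# * weight R (λ e → - half * α e) A) * (minor A (spins S) * minor A (spins S))
          ≈⟨ *-cong (trans (*-identityˡ _) (trans (weight-scale (- half) α A)
               (*-congʳ (reflexive (≡.cong ((- half) ^_) cut≡))))) square ⟩
        ((- half * ((- half) ^ k)) * weight R α A) * ((pow2 R k * (2# - o)) * (pow2 R k * (2# - o)))
          ≈⟨ solve 5 (λ h z w p o → ((:- h :* z) :* w) :* ((p :* (con (+ 2) :- o)) :* (p :* (con (+ 2) :- o))) :=
               (:- (h :* (z :* (p :* p)))) :* (w :* ((o :- con (+ 2)) :* (o :- con (+ 2)))))
               refl half ((- half) ^ k) (weight R α A) (pow2 R k) o ⟩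
        - (half * (((- half) ^ k) * (pow2 R k * pow2 R k))) * (weight R α A * ((o - 2#) * (o - 2#)))
          ≈⟨ *-congʳ (-‿cong (trans (*-congˡ (half-power k)) (trans
               (solve 3 (λ h s p → h :* (s :* p) := s :* (h :* p)) refl half (sgn R k) (pow2 R k))
               (*-congˡ (sym (pow2m1≈ k)))))) ⟩
        - scale * (weight R α A * ((o - 2#) * (o - 2#))) ∎
        where o = natR R (outdeg G Fl)

      zero-summand : ∀ A → minor A (bordered S) ≈ 0# → summand A ≈ 0#
      zero-summand A minor≈0 = trans (*-congˡ (trans (*-congʳ minor≈0) (zeroˡ _))) (zeroʳ _)

      det-formula :
        (L₁ : List (Subset m)) → Unique L₁ → (∀ A → (A ∈L L₁) ⇔ IsF1 G S A) →
        (L₂ : List (Subset m × Subset n)) → Unique L₂ →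
        (∀ A Fl → ((A , Fl) ∈L L₂) ⇔ IsF2 G S A Fl) →
        det R (suc k) (λ i j → D (S i) (S j)) ≈
        sgn R k * (pow2m1 R half k *
          ((sumFin R m α * sumList R (weight R α) L₁)
           - sumList R (λ p → weight R α (proj₁ p) *
                   ((natR R (outdeg G (proj₂ p)) - (1# + 1#)) *
                    (natR R (outdeg G (proj₂ p)) - (1# + 1#)))) L₂))
      det-formula L₁ uniq₁ spec₁ L₂ uniq₂ spec₂ = begin
        det R (suc k) (λ i j → D (S i) (S j))
          ≡⟨ Det≡det _ ⟨
        Det (λ i j → D (S i) (S j))
          ≈⟨ Det-cong (distance S) ⟩
        Det (λ i j → ∑ (λ e → coefficients e * (bordered S e i * bordered S e j)))
          ≈⟨ cauchy-binet coefficients (bordered S) (bordered S) ⟩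
        ∑ˢ summand
          ≈⟨ ∑ˢ-∷ summand ⟩
        -- The head bit belongs to the row of ones: `true` leaves this row out of the minor and
        -- leads to `IsF2`, `false` uses it and leads to `IsF1`.
        ∑ˢ (λ A → summand (true ∷ A)) + ∑ˢ (λ A → summand (false ∷ A))
          ≈⟨ +-cong
               (∑ˢ-list proj₁ L₂ _ _
                 (unique⇒keys-differ proj₁ L₂
                   (λ p∈L q∈L eq → same-key (to₂ p∈L) (to₂ q∈L) eq) uniq₂)
                 (λ p∈L → F2-summand _ _ (to₂ p∈L))
                 (λ A A∉L → zero-summand (true ∷ A) (¬F2-minor S (λ Fl f2 →
                   A∉L (Equivalence.from (spec₂ A Fl) f2) ≡.refl))))
               (∑ˢ-list id L₁ _ _ uniq₁
                 (λ A∈L → F1-summand _ (Equivalence.to (spec₁ _) A∈L))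
                 (λ A A∉L → zero-summand (false ∷ A) (¬F1-minor S (λ f1 →
                   A∉L (Equivalence.from (spec₁ A) f1) ≡.refl)))) ⟩
        sumList R (λ p → - scale * g p) L₂ + sumList R (λ A → (scale * total) * weight R α A) L₁
          ≈⟨ +-cong (sumList-*ˡ (- scale) g L₂) (sumList-*ˡ (scale * total) (weight R α) L₁) ⟩
        - scale * sumList R g L₂ + (scale * total) * sumList R (weight R α) L₁
          ≈⟨ +-congˡ (*-congʳ (*-congˡ (reflexive (∑≡sumFin α)))) ⟩
        - scale * sumList R g L₂ + (scale * sumFin R m α) * sumList R (weight R α) L₁
          ≈⟨ solve 5 (λ s h q t r → :- (s :* h) :* q :+ ((s :* h) :* t) :* r := s :* (h :* (t :* r :- q)))
               refl (sgn R k) (pow2m1 R half k) (sumList R g L₂) (sumFin R m α) (sumList R (weight R α) L₁) ⟩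
        sgn R k * (pow2m1 R half k * ((sumFin R m α * sumList R (weight R α) L₁) - sumList R g L₂)) ∎
        where
        g : Subset m × Subset n → Carrier
        g p = weight R α (proj₁ p) * ((natR R (outdeg G (proj₂ p)) - 2#) * (natR R (outdeg G (proj₂ p)) - 2#))
        to₂ : ∀ {p} → p ∈L L₂ → IsF2 G S (proj₁ p) (proj₂ p)
        to₂ = Equivalence.to (spec₂ _ _)
        same-key : ∀ {p q : Subset m × Subset n} → IsF2 G S (proj₁ p) (proj₂ p) → IsF2 G S (proj₁ q) (proj₂ q) →
          proj₁ p ≡ proj₁ q → p ≡ q
        same-key f2 f2′ ≡.refl = ≡.cong (_ ,_) (F2-unique f2 f2′)

theoremB : ∀ {c ℓ : Level} (R : CommutativeRing c ℓ) →
    let open CommutativeRing R in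
    (half : Carrier) → (1# + 1#) * half ≈ 1# →
    (n m : ℕ) (G : Graph n m) → IsTree G →
    (α : Fin m → Carrier) (D : Fin n → Fin n → Carrier) → IsDistanceMatrix R G α D →
    (k : ℕ) (S : Fin (suc k) → Fin n) → Injective _≡_ _≡_ S →
    (L₁ : List (Subset m)) → Unique L₁ → (∀ A → (A ∈L L₁) ⇔ IsF1 G S A) →
    (L₂ : List (Subset m × Subset n)) → Unique L₂ →
    (∀ A Fl → ((A , Fl) ∈L L₂) ⇔ IsF2 G S A Fl) →
    det R (suc k) (λ i j → D (S i) (S j)) ≈
    sgn R k * (pow2m1 R half k *
    ((sumFin R m α * sumList R (weight R α) L₁)
    - sumList R (λ p → weight R α (proj₁ p) *
    ((natR R (outdeg G (proj₂ p)) - (1# + 1#)) *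
    (natR R (outdeg G (proj₂ p)) - (1# + 1#)))) L₂))
theoremB R half 2half n m G tree α D isD k S _ =
  DistanceMatrix.det-formula R G tree α half 2half D isD S
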